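{- Let $G=(V,E)$ be a finite multigraph (loops allowed). The following are equivalent: (1) $G$ is a $P(2,1)$-graph; (2) $G$ can be constructed from $K_1^1$ or from $K_2^3$ by a finite sequence of 1a, 1b, 2a and 2b moves; (3) $E$ is the disjoint union of the edge sets of a spanning tree $T$ of $G$ and a connected spanning map-graph $M$ of $G$.
   Context: $K_1^1$ is a single vertex with one loop; $K_2^3$ is two vertices with three parallel edges. A graph is $(k,\ell)$-sparse if every subgraph $(V',E')$ with at least one edge has $|E'|\le k|V'|-\ell$, and $(k,\ell)$-tight if also $|E|=k|V|-\ell$. A $P(2,1)$-graph is a $(2,1)$-tight graph $G$ such that $G-e$ is $(2,2)$-tight for some edge $e$. A map-graph is a graph each of whose connected components contains exactly one cycle (a loop counts as a cycle). Moves: (1a) add a new vertex $v_0$ joined by one edge to each of two distinct existing vertices $v_1,v_2$; (1b) add a new vertex $v_0$ joined by two parallel edges to one existing vertex $v_1$; (2a) remove an edge $v_1v_2$ with $v_1\ne v_2$ and add a new vertex $v_0$ joined by one edge to each of $v_1,v_2,v_3$, where $v_3$ is an existing vertex distinct from $v_1,v_2$; (2b) remove an edge $v_1v_2$ with $v_1\ne v_2$ and add a new vertex $v_0$ joined by one edge to $v_1$ and two parallel edges to $v_2$. -}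

module Defs where

open import Data.Nat using (ℕ; zero; suc; _+_; _*_; _≤_)
open import Data.Fin using (Fin; zero; suc; inject₁; fromℕ; _≟_)
open import Data.Fin.Subset using (Subset; _∈_; _⊆_; ∣_∣; Nonempty; ∁)
open import Data.List using (List; []; _∷_; _++_; length; lookup; removeAt; map; allFin)
open import Data.Nat.ListAction using (sum)
open import Data.Product using (_×_; _,_; proj₁; proj₂; Σ; ∃; ∃-syntax; Σ-syntax)
import Data.Product as P
open import Data.Sum using (_⊎_)
open import Data.Empty using (⊥)
open import Relation.Nullary using (¬_; does)
open import Data.Bool using (if_then_else_; true; false)
open import Relation.Binary.PropositionalEquality using (_≡_; _≢_)
open import Function.Bundles using (_↔_; Inverse)

-- A finite multigraph (loops and parallel edges allowed): vertices Fin V,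
-- edges a list (a multiset) of endpoint pairs; the order inside a pair is
-- irrelevant (all notions below are symmetric in the two endpoints).
record Graph : Set where
  constructor graph
  field
    V : ℕ
    E : List (Fin V × Fin V)
open Graph public

EdgeIx : Graph → Set
EdgeIx G = Fin (length (E G))

ends : (G : Graph) → EdgeIx G → Fin (V G) × Fin (V G)
ends G i = lookup (E G) i

EdgeSet : Graph → Set
EdgeSet G = Subset (length (E G))

-- (k,ℓ)-sparsity and tightness.
-- |E'| ≤ k|V'| - ℓ is written |E'| + ℓ ≤ k|V'| (same meaning over ℤ).

Sparse : ℕ → ℕ → Graph → Set
Sparse k ℓ G =
  (V' : Subset (V G)) (E' : EdgeSet G) →
  Nonempty E' →
  (∀ i → i ∈ E' → (proj₁ (ends G i) ∈ V') × (proj₂ (ends G i) ∈ V')) →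
  ∣ E' ∣ + ℓ ≤ k * ∣ V' ∣

Tight : ℕ → ℕ → Graph → Set
Tight k ℓ G = Sparse k ℓ G × (length (E G) + ℓ ≡ k * V G)

deleteEdge : (G : Graph) → EdgeIx G → Graph
deleteEdge G i = graph (V G) (removeAt (E G) i)

P21 : Graph → Set
P21 G = Tight 2 1 G × Σ[ e ∈ EdgeIx G ] Tight 2 2 (deleteEdge G e)

Joins : (G : Graph) → EdgeIx G → Fin (V G) → Fin (V G) → Set
Joins G i u w = (ends G i ≡ (u , w)) ⊎ (ends G i ≡ (w , u))

data Reach (G : Graph) (S : EdgeSet G) : Fin (V G) → Fin (V G) → Set where
  here : ∀ {u} → Reach G S u u
  step : ∀ {u w v} (i : EdgeIx G) → i ∈ S → Joins G i u w →
         Reach G S w v → Reach G S u v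

Connected : (G : Graph) → EdgeSet G → Set
Connected G S = ∀ u v → Reach G S u v

-- number of endpoints of edge i equal to v (a loop at v counts 2)
incid : (G : Graph) → EdgeIx G → Fin (V G) → ℕ
incid G i v = (if does (proj₁ (ends G i) ≟ v) then 1 else 0)
            + (if does (proj₂ (ends G i) ≟ v) then 1 else 0)

degree : (G : Graph) → EdgeSet G → Fin (V G) → ℕ
degree G S v =
  sum (map (λ i → if does (Data.Fin.Subset.Properties._∈?_ i S) then incid G i v else 0)
           (allFin (length (E G))))
  where import Data.Fin.Subset.Properties

Incident : (G : Graph) → Fin (V G) → EdgeSet G → Set
Incident G v C = ∃[ i ] (i ∈ C × ∃[ w ] Joins G i v w)

-- a cycle = nonempty edge set forming a connected 2-regular subgraph
-- (a loop is a cycle of length 1, two parallel edges a cycle of length 2)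
IsCycle : (G : Graph) → EdgeSet G → Set
IsCycle G C =
  Nonempty C ×
  (∀ v → (degree G C v ≡ 0) ⊎ (degree G C v ≡ 2)) ×
  (∀ u v → Incident G u C → Incident G v C → Reach G C u v)

Acyclic : (G : Graph) → EdgeSet G → Set
Acyclic G S = ∀ C → C ⊆ S → ¬ IsCycle G C

IsSpanningTree : (G : Graph) → EdgeSet G → Set
IsSpanningTree G T = Connected G T × Acyclic G T

-- connected spanning map-graph with edge set M: connected, and its unique
-- component contains exactly one cycle
IsConnectedSpanningMapGraph : (G : Graph) → EdgeSet G → Set
IsConnectedSpanningMapGraph G M =
  Connected G M ×
  Σ[ C ∈ EdgeSet G ] (C ⊆ M × IsCycle G C ×
    (∀ C' → C' ⊆ M → IsCycle G C' → C' ≡ C))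

-- condition (3): E = T ⊔ M (M is the complement of T in E)
TreeMapDecomposition : Graph → Set
TreeMapDecomposition G =
  Σ[ T ∈ EdgeSet G ] (IsSpanningTree G T × IsConnectedSpanningMapGraph G (∁ T))

_≅_ : Graph → Graph → Set
G ≅ H =
  Σ[ σ ∈ Fin (V G) ↔ Fin (V H) ] Σ[ τ ∈ EdgeIx G ↔ EdgeIx H ]
    (∀ i → Joins H (Inverse.to τ i)
                   (Inverse.to σ (proj₁ (ends G i)))
                   (Inverse.to σ (proj₂ (ends G i))))

-- Base graphs and moves.  The new vertex v0 is the last vertex fromℕ n;
-- old vertices are embedded by inject₁.

K11 : Graph
K11 = graph 1 ((zero , zero) ∷ [])

K23 : Graph
K23 = graph 2 ((zero , suc zero) ∷ (zero , suc zero) ∷ (zero , suc zero) ∷ [])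

liftE : ∀ {n} → List (Fin n × Fin n) → List (Fin (suc n) × Fin (suc n))
liftE = map (P.map inject₁ inject₁)

move1a : (G : Graph) → Fin (V G) → Fin (V G) → Graph
move1a G v1 v2 = graph (suc (V G))
  (liftE (E G) ++ (fromℕ (V G) , inject₁ v1) ∷ (fromℕ (V G) , inject₁ v2) ∷ [])

move1b : (G : Graph) → Fin (V G) → Graph
move1b G v1 = graph (suc (V G))
  (liftE (E G) ++ (fromℕ (V G) , inject₁ v1) ∷ (fromℕ (V G) , inject₁ v1) ∷ [])

move2a : (G : Graph) → EdgeIx G → Fin (V G) → Fin (V G) → Fin (V G) → Graph
move2a G e v1 v2 v3 = graph (suc (V G))
  (liftE (removeAt (E G) e) ++ (fromℕ (V G) , inject₁ v1)
     ∷ (fromℕ (V G) , inject₁ v2) ∷ (fromℕ (V G) , inject₁ v3) ∷ [])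

move2b : (G : Graph) → EdgeIx G → Fin (V G) → Fin (V G) → Graph
move2b G e v1 v2 = graph (suc (V G))
  (liftE (removeAt (E G) e) ++ (fromℕ (V G) , inject₁ v1)
     ∷ (fromℕ (V G) , inject₁ v2) ∷ (fromℕ (V G) , inject₁ v2) ∷ [])

data Constructible : Graph → Set where
  baseK11 : Constructible K11
  baseK23 : Constructible K23
  iso     : ∀ {G H} → G ≅ H → Constructible G → Constructible H
  step1a  : ∀ {G} (v1 v2 : Fin (V G)) → v1 ≢ v2 →
            Constructible G → Constructible (move1a G v1 v2)
  step1b  : ∀ {G} (v1 : Fin (V G)) →
            Constructible G → Constructible (move1b G v1)
  step2a  : ∀ {G} (e : EdgeIx G) (v1 v2 v3 : Fin (V G)) →
            Joins G e v1 v2 → v1 ≢ v2 → v3 ≢ v1 → v3 ≢ v2 →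
            Constructible G → Constructible (move2a G e v1 v2 v3)
  step2b  : ∀ {G} (e : EdgeIx G) (v1 v2 : Fin (V G)) →
            Joins G e v1 v2 → v1 ≢ v2 →
            Constructible G → Constructible (move2b G e v1 v2)

{-# OPTIONS --safe #-}
-- G is a P(2,1)-graph iff G = H + e with H (2,2)-tight, the bounds for G being then automatic.
--
-- (1) ⇒ (2): induction on |V|.  Counting e = ab twice, the degrees of H + 2e sum to 4|V|.
-- Either a vertex v away from e has degree 2 or 3 in H, and v is removed by an inverse move of H
-- (in degree 3 one of the possible new edges is not blocked by a tight set: the union of two
-- blocking sets would be tight and contain all neighbours of v); or a and b have degree 2 in H,
-- and an inverse 2-move removes a together with e, since H - a plus any edge is again of this
-- kind.  The latter fails only if all three edges at a go to b, and then G = K_2^3.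
--
-- (2) ⇒ (3): by counting edges, (3) says that E splits into two connected spanning sets with
-- |V| - 1 and |V| edges.  A new vertex is a leaf of both parts or a leaf of one and a subdivision
-- vertex of the other.
--
-- (3) ⇒ (1): some edge e of the cycle leaves M - e connected, so G - e is the union of two
-- connected spanning sets with |V| - 1 edges; each has at most |X| - 1 edges inside X.
module Submission where

open import Defs
open import Data.Bool using (Bool; true; false; T; _∧_; _∨_; _xor_; not; if_then_else_)
import Data.Bool as Bool
open import Data.Bool.Properties using (not-involutive; xor-assoc; xor-comm; ∧-comm; ∧-zeroʳ; ∧-identityʳ; xor-identityʳ; ∨-zeroʳ)
open import Data.Bool.Solver using (module xor-∧-Solver)
open import Data.Fin using (Fin; zero; suc; inject₁; fromℕ; punchIn; punchOut; _≟_)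
open import Data.Fin.Permutation using (Permutation; _⟨$⟩ʳ_; _⟨$⟩ˡ_; remove; refute; punchIn-permute; cast-id; inverseˡ; inverseʳ)
import Data.Fin.Permutation as Permutation
open import Data.Fin.Properties using (any?; punchIn-punchOut; punchInᵢ≢i; punchOut-cong; punchOut-punchIn; inject₁-injective; fromℕ≢inject₁)
open import Data.Fin.Relation.Unary.Top using (view; ‵fromℕ; ‵inject₁; view-fromℕ; view-inject₁)
open import Data.Fin.Subset using (Subset; inside; outside; _∈_; _∉_; _⊆_; ∣_∣; ∁; ⊥)
open import Data.Fin.Subset.Properties using (_∈?_; drop-∷-⊆; ∉⊥; nonempty?; anySubset?; x∉p⇒x∈∁p)
open import Data.List using (List; []; _∷_; _++_; length; lookup; removeAt; map; tabulate; filterᵇ)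
import Data.List.Membership.Propositional as List
open import Data.List.Membership.Propositional using (find; lose)
open import Data.List.Membership.Propositional.Properties using (∈-filter⁺)
open import Data.List.Properties using (tabulate-lookup; map-tabulate; map-++; length-map; length-++; map-∘; map-cong; map-id; length-removeAt′)
import Data.List.Relation.Binary.Permutation.Homogeneous as Homogeneous
import Data.List.Relation.Binary.Permutation.Setoid as PermutationSetoid
import Data.List.Relation.Binary.Permutation.Setoid.Properties as PermutationProperties
open import Data.List.Relation.Binary.Pointwise using ([]; _∷_)
open import Data.List.Relation.Unary.Any using (Any; here; there)
import Data.List.Relation.Unary.Any as Any
import Data.List.Relation.Unary.Any.Properties as Any
open import Data.Nat using (ℕ; zero; suc; _+_; _*_; _≤_; _<_; z≤n; s≤s)
open import Data.Nat.ListAction using (sum)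
open import Data.Nat.ListAction.Properties using (sum-++)
open import Data.Nat.Properties hiding (_≟_)
open import Data.Nat.Solver using (module +-*-Solver)
open import Data.Product using (_×_; _,_; proj₁; proj₂; ∃-syntax; Σ-syntax; swap)
import Data.Product as Product
open import Data.Sum using (_⊎_; inj₁; inj₂)
import Data.Sum as Sum
open import Data.Vec using ([]; _∷_; here; there; _[_]≔_)
import Data.Vec as Vec
open import Data.Vec.Properties using ([]≔-updates; []≔-minimal; lookup⇒[]=; []=⇒lookup; lookup∘tabulate; lookup∘update; lookup∘update′; lookup-zipWith)
open import Function using (_∘_; id)
open import Function.Bundles using (_⇔_; mk⇔; Inverse)
open import Level using (0ℓ)
open import Relation.Binary using (Setoid)
open import Relation.Binary.Construct.Closure.ReflexiveTransitive using (Star; ε; _◅_; _◅◅_; kleisliStar; reverse)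
open import Relation.Binary.PropositionalEquality
open import Relation.Nullary using (¬_; Dec; yes; no; does; contradiction)
open import Relation.Nullary.Decidable using (dec-true; dec-false; _×-dec_)
open import Algebra.Properties.CommutativeMonoid.Sum +-0-commutativeMonoid using (∑-distrib-+; sum-cong-≗; sum-permute; sum-init-last; sum-replicate-zero) renaming (sum to ∑)
open import Algebra.Properties.CommutativeSemigroup +-commutativeSemigroup using (interchange; x∙yz≈y∙xz)

-- The obstacle in (1) ⇒ (2) is that a vertex of small degree in H may be an end of e, and removing
-- it would take e away too. Since H has minimum degree 2, an end of e has degree at least 2 + 2 in
-- H + 2e, so a vertex of degree at most 3 there misses e; and as the average is exactly 4, the
-- absence of such a vertex forces every degree to be 4. The induction runs over H with an arbitrary
-- extra edge, loops included, so that any pair of vertices can take over the role of e.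
--
-- The conditions on cycles in (3) are hard to follow through subdivisions, while connectivity and
-- the number of edges are easy; cycles appear only in the translation between the two forms. It
-- rests on three facts: a connected graph on n vertices has at least n - 1 edges, among n edges
-- there is one whose ends stay joined without it, and no nonempty edge set of a tree has all
-- degrees even. One induction scheme proves all three: contract the first edge.

Edge : ℕ → Set
Edge n = Fin n × Fin n

-- Edge lists up to orientation and order

infix 4 _≈_

_≈_ : ∀ {n} → Edge n → Edge n → Set
e ≈ f = e ≡ f ⊎ e ≡ swap f

≈-sym : ∀ {n} {e f : Edge n} → e ≈ f → f ≈ e
≈-sym (inj₁ refl) = inj₁ refl
≈-sym (inj₂ refl) = inj₂ refl

≈-trans : ∀ {n} {e f g : Edge n} → e ≈ f → f ≈ g → e ≈ g
≈-trans (inj₁ refl) f≈g         = f≈g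
≈-trans (inj₂ refl) (inj₁ refl) = inj₂ refl
≈-trans (inj₂ refl) (inj₂ refl) = inj₁ refl

edgeSetoid : ℕ → Setoid 0ℓ 0ℓ
edgeSetoid n = record
  { Carrier       = Edge n
  ; _≈_           = _≈_
  ; isEquivalence = record { refl = inj₁ refl ; sym = ≈-sym ; trans = ≈-trans }
  }

module _ {n : ℕ} where
  open PermutationSetoid (edgeSetoid n) public
    using (_↭_; ↭-refl; ↭-reflexive; ↭-sym; ↭-trans; ↭-prep; ↭-swap)
  open PermutationProperties (edgeSetoid n) public
    using (Any-resp-↭; xs↭ys⇒|xs|≡|ys|; ↭-shift; ++⁺ˡ; ++⁺ʳ; ++⁺; ++-comm; drop-∷; onIndices-lookup)

mapE : ∀ {m n} → (Fin m → Fin n) → Edge m → Edge n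
mapE f = Product.map f f

mapE-≈ : ∀ {m n} (f : Fin m → Fin n) {e e′ : Edge m} → e ≈ e′ → mapE f e ≈ mapE f e′
mapE-≈ f (inj₁ refl) = inj₁ refl
mapE-≈ f (inj₂ refl) = inj₂ refl

map-↭ : ∀ {m n} (f : Fin m → Fin n) {es es′ : List (Edge m)} → es ↭ es′ → map (mapE f) es ↭ map (mapE f) es′
map-↭ {m} {n} f = PermutationProperties.map⁺ (edgeSetoid m) (edgeSetoid n) (mapE-≈ f)

removeAt-↭ : ∀ {n} (es : List (Edge n)) i → es ↭ lookup es i ∷ removeAt es i
removeAt-↭ (e ∷ es) zero    = ↭-refl
removeAt-↭ (e ∷ es) (suc i) = ↭-trans (↭-prep e (removeAt-↭ es i)) (↭-swap e _ ↭-refl)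

tabulate-punchIn-↭ : ∀ {n k} (g : Fin (suc k) → Edge n) j → tabulate g ↭ g j ∷ tabulate (g ∘ punchIn j)
tabulate-punchIn-↭             g zero    = ↭-refl
tabulate-punchIn-↭ {k = suc k} g (suc j) =
  ↭-trans (↭-prep _ (tabulate-punchIn-↭ (g ∘ suc) j)) (↭-swap _ _ ↭-refl)

-- Peeling off index `zero` together with its image turns the bijection of edge indices in `_≅_`
-- into a permutation of lists.
tabulate-↭ : ∀ {n k l} (f : Fin k → Edge n) (g : Fin l → Edge n) (π : Permutation k l) →
             (∀ i → f i ≈ g (π ⟨$⟩ʳ i)) → tabulate f ↭ tabulate g
tabulate-↭ {k = zero}  {zero}  f g π f≈g = ↭-refl
tabulate-↭ {k = zero}  {suc l} f g π f≈g = contradiction π (refute λ())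
tabulate-↭ {k = suc k} {zero}  f g π f≈g = contradiction π (refute λ())
tabulate-↭ {k = suc k} {suc l} f g π f≈g =
  ↭-trans (Homogeneous.prep (f≈g zero) (tabulate-↭ (f ∘ suc) (g ∘ punchIn (π ⟨$⟩ʳ zero)) (remove zero π) rest))
          (↭-sym (tabulate-punchIn-↭ g (π ⟨$⟩ʳ zero)))
  where
  rest : ∀ i → f (suc i) ≈ g (punchIn (π ⟨$⟩ʳ zero) (remove zero π ⟨$⟩ʳ i))
  rest i = subst (λ j → f (suc i) ≈ g j) (punchIn-permute π zero i) (f≈g (suc i))

≅⇒↭ : ∀ {G H} (iso : G ≅ H) → map (mapE (Inverse.to (proj₁ iso))) (E G) ↭ E H
≅⇒↭ {G} {H} (σ , τ , joins) =
  subst₂ _↭_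
    (trans (sym (map-tabulate (lookup (E G)) (mapE (Inverse.to σ)))) (cong (map _) (tabulate-lookup (E G))))
    (tabulate-lookup (E H))
    (tabulate-↭ _ (lookup (E H)) τ (≈-sym ∘ joins))

↭⇒≅ : ∀ {n} {es es′ : List (Edge n)} → es ↭ es′ → graph n es ≅ graph n es′
↭⇒≅ es↭es′ = Permutation.id , Homogeneous.onIndices es↭es′ , ≈-sym ∘ onIndices-lookup es↭es′

lookup-map-cast : ∀ {m n} (f : Edge m → Edge n) es i →
                  lookup (map f es) (cast-id (sym (length-map f es)) ⟨$⟩ʳ i) ≡ f (lookup es i)
lookup-map-cast f (e ∷ es) zero    = refl
lookup-map-cast f (e ∷ es) (suc i) = lookup-map-cast f es i

relabel-≅ : ∀ {m n} (π : Permutation m n) es → graph m es ≅ graph n (map (mapE (π ⟨$⟩ʳ_)) es)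
relabel-≅ π es = π , cast-id (sym (length-map _ es)) , inj₁ ∘ lookup-map-cast (mapE (π ⟨$⟩ʳ_)) es

constructible-↭ : ∀ {n} {es es′ : List (Edge n)} → es ↭ es′ → Constructible (graph n es) → Constructible (graph n es′)
constructible-↭ = iso ∘ ↭⇒≅

-- Weighted counts of edges and vertices

𝟙 : Bool → ℕ
𝟙 b = if b then 1 else 0

-- The number of edges, the edges inside a vertex set and the degrees are all sums of this form, so
-- invariance under permutation and additivity are shown once for every weight.
total : {A : Set} → (A → ℕ) → List A → ℕ
total w xs = sum (map w xs)

total-++ : {A : Set} (w : A → ℕ) (xs ys : List A) → total w (xs ++ ys) ≡ total w xs + total w ys
total-++ w xs ys = trans (cong sum (map-++ w xs ys)) (sum-++ (map w xs) (map w ys))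

total-map : {A B : Set} (w : B → ℕ) (f : A → B) (xs : List A) → total w (map f xs) ≡ total (w ∘ f) xs
total-map w f xs = cong sum (sym (map-∘ xs))

total-cong : {A : Set} {w w′ : A → ℕ} → (∀ x → w x ≡ w′ x) → (xs : List A) → total w xs ≡ total w′ xs
total-cong eq xs = cong sum (map-cong eq xs)

total-≤ : {A : Set} {w w′ : A → ℕ} → (∀ x → w x ≤ w′ x) → (xs : List A) → total w xs ≤ total w′ xs
total-≤ le []       = z≤n
total-≤ le (x ∷ xs) = +-mono-≤ (le x) (total-≤ le xs)

total-+ : {A : Set} (w w′ : A → ℕ) (xs : List A) → total (λ x → w x + w′ x) xs ≡ total w xs + total w′ xs
total-+ w w′ []       = refl
total-+ w w′ (x ∷ xs) = trans (cong (w x + w′ x +_) (total-+ w w′ xs)) (interchange (w x) (w′ x) _ _)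

total-1 : {A : Set} (xs : List A) → total (λ _ → 1) xs ≡ length xs
total-1 []       = refl
total-1 (x ∷ xs) = cong suc (total-1 xs)

total-↭ : ∀ {n} (w : Edge n → ℕ) → (∀ {e f} → e ≈ f → w e ≡ w f) →
          ∀ {es es′} → es ↭ es′ → total w es ≡ total w es′
total-↭ w resp (Homogeneous.refl [])          = refl
total-↭ w resp (Homogeneous.refl (e≈f ∷ eqs)) = cong₂ _+_ (resp e≈f) (total-↭ w resp (Homogeneous.refl eqs))
total-↭ w resp (Homogeneous.prep e≈f p)       = cong₂ _+_ (resp e≈f) (total-↭ w resp p)
total-↭ w resp (Homogeneous.swap {x = e} {y = f} {x′ = e′} {y′ = f′} e≈ f≈ p)
  rewrite resp e≈ | resp f≈ | total-↭ w resp p = x∙yz≈y∙xz (w e′) (w f′) _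
total-↭ w resp (Homogeneous.trans p q)        = trans (total-↭ w resp p) (total-↭ w resp q)

total-removeAt : {A : Set} (w : A → ℕ) (xs : List A) (i : Fin (length xs)) →
                 total w xs ≡ w (lookup xs i) + total w (removeAt xs i)
total-removeAt w (x ∷ xs) zero    = refl
total-removeAt w (x ∷ xs) (suc i) rewrite total-removeAt w xs i = x∙yz≈y∙xz (w x) (w (lookup xs i)) _

∧-true : ∀ {a b} → a ∧ b ≡ true → a ≡ true × b ≡ true
∧-true {true} {true} _ = refl , refl

δ : ∀ {n} → Fin n → Fin n → Bool
δ x y = does (x ≟ y)

δ-refl : ∀ {n} (x : Fin n) → δ x x ≡ true
δ-refl x = dec-true (x ≟ x) refl

δ-≢ : ∀ {n} {x y : Fin n} → x ≢ y → δ x y ≡ false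
δ-≢ {x = x} {y} = dec-false (x ≟ y)

inX : ∀ {n} → (Fin n → Bool) → Edge n → Bool
inX X (u , v) = X u ∧ X v

count : ∀ {n} → (Fin n → Bool) → List (Edge n) → ℕ
count X = total (𝟙 ∘ inX X)

incidence : ∀ {n} → Fin n → Edge n → ℕ
incidence x (u , v) = 𝟙 (δ u x) + 𝟙 (δ v x)

deg : ∀ {n} → Fin n → List (Edge n) → ℕ
deg x = total (incidence x)

inX-≈ : ∀ {n} (X : Fin n → Bool) {e f : Edge n} → e ≈ f → 𝟙 (inX X e) ≡ 𝟙 (inX X f)
inX-≈ X         (inj₁ refl) = refl
inX-≈ X {u , v} (inj₂ refl) = cong 𝟙 (∧-comm (X u) (X v))

incidence-≈ : ∀ {n} (x : Fin n) {e f : Edge n} → e ≈ f → incidence x e ≡ incidence x f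
incidence-≈ x         (inj₁ refl) = refl
incidence-≈ x {u , v} (inj₂ refl) = +-comm (𝟙 (δ u x)) _

count-↭ : ∀ {n} (X : Fin n → Bool) {es es′} → es ↭ es′ → count X es ≡ count X es′
count-↭ X = total-↭ _ (inX-≈ X)

deg-↭ : ∀ {n} (x : Fin n) {es es′} → es ↭ es′ → deg x es ≡ deg x es′
deg-↭ x = total-↭ _ (incidence-≈ x)

size : ∀ {n} → (Fin n → Bool) → ℕ
size X = ∑ (𝟙 ∘ X)

∑-δ : ∀ {n} (x : Fin n) → ∑ (𝟙 ∘ δ x) ≡ 1
∑-δ {suc n} zero    = cong suc (sum-replicate-zero n)
∑-δ         (suc x) = ∑-δ x

size-minus : ∀ {n} (X : Fin n → Bool) x → X x ≡ true → size X ≡ suc (size (λ y → not (δ x y) ∧ X y))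
size-minus X x x∈X =
  trans (sum-cong-≗ split) (trans (∑-distrib-+ (𝟙 ∘ δ x) _) (cong (_+ size (λ y → not (δ x y) ∧ X y)) (∑-δ x)))
  where
  split : ∀ y → 𝟙 (X y) ≡ 𝟙 (δ x y) + 𝟙 (not (δ x y) ∧ X y)
  split y with x ≟ y
  ... | yes refl = cong 𝟙 x∈X
  ... | no  _    = refl

size-tabulate : ∀ {n} (X : Fin n → Bool) → ∣ Vec.tabulate X ∣ ≡ size X
size-tabulate {zero}  X = refl
size-tabulate {suc n} X with X zero
... | true  = cong suc (size-tabulate (X ∘ suc))
... | false = size-tabulate (X ∘ suc)

size-lookup : ∀ {n} (p : Subset n) → ∣ p ∣ ≡ size (Vec.lookup p)
size-lookup []            = refl
size-lookup (outside ∷ p) = size-lookup p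
size-lookup (inside ∷ p)  = cong suc (size-lookup p)

size-⊤ : ∀ n → size {n} (λ _ → true) ≡ n
size-⊤ zero    = refl
size-⊤ (suc n) = cong suc (size-⊤ n)

-- One-step linear arithmetic: add up inequalities into a ≤ b and compare.
linear : ∀ {a b} p q → a ≤ b → p + b ≡ q + a → p ≤ q
linear {a} {b} p q a≤b eq = +-cancelʳ-≤ a p q (≤-trans (+-monoʳ-≤ p a≤b) (≤-reflexive eq))

-- Selecting a subfamily of edges

select : {A : Set} {k : ℕ} → (Fin k → A) → Subset k → List A
select f []            = []
select f (inside  ∷ S) = f zero ∷ select (f ∘ suc) S
select f (outside ∷ S) = select (f ∘ suc) S

length-select : {A : Set} {k : ℕ} (f : Fin k → A) (S : Subset k) → length (select f S) ≡ ∣ S ∣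
length-select f []            = refl
length-select f (inside  ∷ S) = cong suc (length-select (f ∘ suc) S)
length-select f (outside ∷ S) = length-select (f ∘ suc) S

select-map : {A B : Set} {k : ℕ} (g : A → B) (f : Fin k → A) (S : Subset k) → select (g ∘ f) S ≡ map g (select f S)
select-map g f []            = refl
select-map g f (inside  ∷ S) = cong (g (f zero) ∷_) (select-map g (f ∘ suc) S)
select-map g f (outside ∷ S) = select-map g (f ∘ suc) S

select-empty : {A : Set} {k : ℕ} (f : Fin k → A) (S : Subset k) → (∀ i → i ∉ S) → select f S ≡ []
select-empty f []            empty = refl
select-empty f (inside  ∷ S) empty = contradiction here (empty zero)
select-empty f (outside ∷ S) empty = select-empty (f ∘ suc) S (λ i → empty (suc i) ∘ there)

Any-select⁺ : {A : Set} {P : A → Set} {k : ℕ} (f : Fin k → A) {S : Subset k} {i : Fin k} → i ∈ S → P (f i) → Any P (select f S)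
Any-select⁺ f               here        p = here p
Any-select⁺ f {inside  ∷ S} (there i∈S) p = there (Any-select⁺ (f ∘ suc) i∈S p)
Any-select⁺ f {outside ∷ S} (there i∈S) p = Any-select⁺ (f ∘ suc) i∈S p

Any-select⁻ : {A : Set} {P : A → Set} {k : ℕ} (f : Fin k → A) (S : Subset k) → Any P (select f S) → ∃[ i ] i ∈ S × P (f i)
Any-select⁻ f (inside  ∷ S) (here p)  = zero , here , p
Any-select⁻ f (inside  ∷ S) (there q) with i , i∈S , p ← Any-select⁻ (f ∘ suc) S q = suc i , there i∈S , p
Any-select⁻ f (outside ∷ S) q         with i , i∈S , p ← Any-select⁻ (f ∘ suc) S q = suc i , there i∈S , p

total-select-delete : {A : Set} {k : ℕ} (w : A → ℕ) (f : Fin k → A) {S : Subset k} {i : Fin k} → i ∈ S →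
                      total w (select f S) ≡ w (f i) + total w (select f (S [ i ]≔ outside))
total-select-delete w f               here        = refl
total-select-delete w f {inside  ∷ S} {suc i} (there i∈S) =
  trans (cong (w (f zero) +_) (total-select-delete w (f ∘ suc) i∈S)) (x∙yz≈y∙xz (w (f zero)) (w (f (suc i))) _)
total-select-delete w f {outside ∷ S} (there i∈S) = total-select-delete w (f ∘ suc) i∈S

total-select-insert : {A : Set} {k : ℕ} (w : A → ℕ) (f : Fin k → A) {S : Subset k} {i : Fin k} → i ∉ S →
                      total w (select f (S [ i ]≔ inside)) ≡ w (f i) + total w (select f S)
total-select-insert w f {inside  ∷ S} {zero}  i∉S = contradiction here i∉S
total-select-insert w f {outside ∷ S} {zero}  i∉S = refl
total-select-insert w f {inside  ∷ S} {suc i} i∉S =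
  trans (cong (w (f zero) +_) (total-select-insert w (f ∘ suc) (i∉S ∘ there))) (x∙yz≈y∙xz (w (f zero)) (w (f (suc i))) _)
total-select-insert w f {outside ∷ S} {suc i} i∉S = total-select-insert w (f ∘ suc) (i∉S ∘ there)

total-select-∁ : {A : Set} {k : ℕ} (w : A → ℕ) (f : Fin k → A) (S : Subset k) →
                 total w (select f S) + total w (select f (∁ S)) ≡ total w (tabulate f)
total-select-∁ w f []            = refl
total-select-∁ w f (inside  ∷ S) =
  trans (+-assoc (w (f zero)) _ _) (cong (w (f zero) +_) (total-select-∁ w (f ∘ suc) S))
total-select-∁ w f (outside ∷ S) =
  trans (x∙yz≈y∙xz (total w (select (f ∘ suc) S)) (w (f zero)) _) (cong (w (f zero) +_) (total-select-∁ w (f ∘ suc) S))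

-- Connectivity

Adj : ∀ {n} → List (Edge n) → Fin n → Fin n → Set
Adj es u w = Any (_≈ (u , w)) es

Path : ∀ {n} → List (Edge n) → Fin n → Fin n → Set
Path es = Star (Adj es)

Conn : ∀ {n} → List (Edge n) → Set
Conn es = ∀ u v → Path es u v

adj-sym : ∀ {n} {es : List (Edge n)} {u w} → Adj es u w → Adj es w u
adj-sym = Any.map λ where
  (inj₁ refl) → inj₂ refl
  (inj₂ refl) → inj₁ refl

path-sym : ∀ {n} {es : List (Edge n)} {u v} → Path es u v → Path es v u
path-sym = reverse adj-sym

path-map : ∀ {n} {es es′ : List (Edge n)} → (∀ {u w} → Adj es u w → Path es′ u w) → ∀ {u v} → Path es u v → Path es′ u v
path-map = kleisliStar id

adj-path : ∀ {n} {es : List (Edge n)} {u w} → Adj es u w → Path es u w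
adj-path a = a ◅ ε

conn-drop-head : ∀ {n} {u v : Fin n} {es : List (Edge n)} → Path es u v → Conn ((u , v) ∷ es) → Conn es
conn-drop-head {u = u} {v} {es} p conn a b = path-map bypass (conn a b)
  where
  bypass : ∀ {a b} → Adj ((u , v) ∷ es) a b → Path es a b
  bypass (here (inj₁ refl)) = p
  bypass (here (inj₂ refl)) = path-sym p
  bypass (there a)          = adj-path a

module Contract {n : ℕ} (u v : Fin (suc n)) (u≢v : u ≢ v) where

  -- Contraction of uv without a quotient: `u` is dropped from the vertex set and redirected to the
  -- image of `v`, which makes `punchIn u` a section.
  merge : Fin (suc n) → Fin n
  merge x with u ≟ x
  ... | yes _  = punchOut u≢v
  ... | no u≢x = punchOut u≢x

  merge-u : merge u ≡ punchOut u≢v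
  merge-u with u ≟ u
  ... | yes _  = refl
  ... | no u≢u = contradiction refl u≢u

  merge-v : merge v ≡ punchOut u≢v
  merge-v with u ≟ v
  ... | yes _ = refl
  ... | no _  = punchOut-cong u refl

  merge-punchIn : ∀ j → merge (punchIn u j) ≡ j
  merge-punchIn j with u ≟ punchIn u j
  ... | yes eq = contradiction (sym eq) (punchInᵢ≢i u j)
  ... | no _   = trans (punchOut-cong u refl) (punchOut-punchIn u)

  contract : List (Edge (suc n)) → List (Edge n)
  contract = map (mapE merge)

  contract-adj : ∀ {es a b} → Adj ((u , v) ∷ es) a b → Path (contract es) (merge a) (merge b)
  contract-adj (here (inj₁ refl)) rewrite merge-u | merge-v = ε
  contract-adj (here (inj₂ refl)) rewrite merge-u | merge-v = ε
  contract-adj (there a) = adj-path (Any.map⁺ (Any.map (mapE-≈ merge) a))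

  contract-conn : ∀ {es} → Conn ((u , v) ∷ es) → Conn (contract es)
  contract-conn {es} conn c d =
    subst₂ (Path (contract es)) (merge-punchIn c) (merge-punchIn d)
      (kleisliStar merge contract-adj (conn (punchIn u c) (punchIn u d)))

  merge-path : ∀ {es} x → Path ((u , v) ∷ es) x (punchIn u (merge x))
  merge-path x with u ≟ x
  ... | yes refl rewrite punchIn-punchOut u≢v = adj-path (here (inj₁ refl))
  ... | no u≢x   rewrite punchIn-punchOut u≢x = ε

  lift-adj : ∀ {es c d} → Adj (contract es) c d → Path ((u , v) ∷ es) (punchIn u c) (punchIn u d)
  lift-adj a with find (Any.map⁻ a)
  ... | (x , y) , e∈es , inj₁ refl =
    path-sym (merge-path x) ◅◅ there (lose e∈es (inj₁ refl)) ◅ merge-path y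
  ... | (x , y) , e∈es , inj₂ refl =
    path-sym (merge-path y) ◅◅ there (lose e∈es (inj₂ refl)) ◅ merge-path x

  lift-path : ∀ {es a b} → Path (contract es) (merge a) (merge b) → Path ((u , v) ∷ es) a b
  lift-path {a = a} {b} p =
    merge-path a ◅◅ kleisliStar (punchIn u) lift-adj p ◅◅ path-sym (merge-path b)

conn⇒length : ∀ {n} (es : List (Edge n)) → Conn es → n ≤ suc (length es)
conn⇒length {n} es = go (length es) es refl
  where
  -- Recursion on the length, since the contracted list is not a sublist.
  go : ∀ k {n} (es : List (Edge n)) → length es ≡ k → Conn es → n ≤ suc k
  go k {zero}        es len conn = z≤n
  go k {suc zero}    es len conn = s≤s z≤n
  go k {suc (suc n)} [] len conn with conn zero (suc zero)
  ... | () ◅ _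
  go (suc k) {suc (suc n)} ((u , v) ∷ es) len conn with u ≟ v
  ... | yes refl = m≤n⇒m≤1+n (go k es (suc-injective len) (conn-drop-head ε conn))
  ... | no u≢v   =
    s≤s (go k (contract es) (trans (length-map _ es) (suc-injective len)) (contract-conn conn))
    where open Contract u v u≢v

-- A first loop is redundant itself. Otherwise an edge that is redundant after contracting the first
-- one was redundant before, its path being lifted through the contracted edge. The argument of type
-- `Fin n` excludes `n = 0`, where the empty family would be a counterexample.
redundant-edge : ∀ {k n} (f : Fin k → Edge n) (S : Subset k) → Fin n → n ≤ length (select f S) →
                 ∃[ i ] i ∈ S × Path (select f (S [ i ]≔ outside)) (proj₁ (f i)) (proj₂ (f i))
redundant-edge {n = suc n} f [] x ()
redundant-edge f (outside ∷ S) x n≤ with i , i∈S , p ← redundant-edge (f ∘ suc) S x n≤ = suc i , there i∈S , p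
redundant-edge {n = suc n} f (inside ∷ S) x (s≤s n≤) with proj₁ (f zero) ≟ proj₂ (f zero)
... | yes eq = zero , here , subst (Path _ _) eq ε
... | no u≢v = suc (proj₁ found) , there (proj₁ (proj₂ found)) ,
    lift-path (subst (λ es → Path es (merge (proj₁ e)) (merge (proj₂ e)))
      (select-map (mapE merge) (f ∘ suc) (S [ proj₁ found ]≔ outside)) (proj₂ (proj₂ found)))
  where
  open Contract (proj₁ (f zero)) (proj₂ (f zero)) u≢v
  length-contract : length (select (f ∘ suc) S) ≡ length (select (mapE merge ∘ f ∘ suc) S)
  length-contract = trans (length-select (f ∘ suc) S) (sym (length-select (mapE merge ∘ f ∘ suc) S))
  found = redundant-edge (mapE merge ∘ f ∘ suc) S (merge x) (subst (n ≤_) length-contract n≤)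
  e = f (suc (proj₁ found))

-- Degree parities and even edge sets

par : ∀ {n} → Fin n → List (Edge n) → Bool
par x []             = false
par x ((u , v) ∷ es) = (δ u x xor δ v x) xor par x es

module _ {n : ℕ} {u v : Fin (suc n)} (u≢v : u ≢ v) where
  open Contract u v u≢v

  δ-punchOut : ∀ {a} (u≢a : u ≢ a) j → δ (punchOut u≢a) j ≡ δ a (punchIn u j)
  δ-punchOut {a} u≢a j with a ≟ punchIn u j
  ... | yes refl = trans (cong (λ i → δ i j) (trans (punchOut-cong u refl) (punchOut-punchIn u))) (δ-refl j)
  ... | no a≢    = δ-≢ λ eq → a≢ (trans (sym (punchIn-punchOut u≢a)) (cong (punchIn u) eq))

  δ-merge : ∀ a j → δ (merge a) j ≡ δ a (punchIn u j) xor (δ v (punchIn u j) ∧ δ a u)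
  δ-merge a j with u ≟ a
  ... | yes refl rewrite δ-refl u | δ-≢ (punchInᵢ≢i u j ∘ sym) | δ-punchOut u≢v j = sym (∧-identityʳ (δ v (punchIn u j)))
  ... | no u≢a rewrite δ-≢ (u≢a ∘ sym) | δ-punchOut u≢a j | ∧-zeroʳ (δ v (punchIn u j)) = sym (xor-identityʳ (δ a (punchIn u j)))

  -- The merged vertex, whose indicator is `δ v (punchIn u j)`, receives the sum of the parities at
  -- `u` and `v`; all other parities are kept.
  par-contract : ∀ es j → par j (contract es) ≡ par (punchIn u j) es xor (δ v (punchIn u j) ∧ par u es)
  par-contract []             j = sym (∧-zeroʳ (δ v (punchIn u j)))
  par-contract ((a , b) ∷ es) j rewrite δ-merge a j | δ-merge b j | par-contract es j =
    rearrange (δ a (punchIn u j)) (δ b (punchIn u j)) (δ v (punchIn u j)) (δ a u) (δ b u) (par (punchIn u j) es) (par u es)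
    where
    rearrange : ∀ a b c d e p q →
      ((a xor (c ∧ d)) xor (b xor (c ∧ e))) xor (p xor (c ∧ q)) ≡ ((a xor b) xor p) xor (c ∧ ((d xor e) xor q))
    rearrange = xor-∧-Solver.solve 7
      (λ a b c d e p q → ((a :+ (c :* d)) :+ (b :+ (c :* e))) :+ (p :+ (c :* q)) := ((a :+ b) :+ p) :+ (c :* ((d :+ e) :+ q))) refl
      where open xor-∧-Solver

-- The first edge uv of the tree is no loop, as dropping a loop would leave a connected graph with
-- too few edges. Evenness survives the contraction of uv, so the rest of `C` is empty by induction;
-- but if `C` contained uv, this rest would have odd degree at u.
tree⇒no-even : ∀ {k n} (f : Fin k → Edge n) (S C : Subset k) → C ⊆ S →
               Conn (select f S) → suc (length (select f S)) ≡ n →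
               (∀ x → par x (select f C) ≡ false) → ∀ i → i ∉ C
tree⇒no-even f [] [] C⊆S conn len even ()
tree⇒no-even f (outside ∷ S) (inside  ∷ C) C⊆S conn len even with C⊆S here
... | ()
tree⇒no-even f (outside ∷ S) (outside ∷ C) C⊆S conn len even (suc i) (there i∈C) =
  tree⇒no-even (f ∘ suc) S C (drop-∷-⊆ C⊆S) conn len even i i∈C
tree⇒no-even {n = suc n} f (inside ∷ S) (c ∷ C) C⊆S conn len even with proj₁ (f zero) ≟ proj₂ (f zero)
... | yes eq = contradiction (conn⇒length _ (conn-drop-head (subst (Path _ _) eq ε) conn)) (<⇒≱ (≤-reflexive len))
... | no u≢v = main c even
  where
  u = proj₁ (f zero)
  v = proj₂ (f zero)
  open Contract u v u≢v
  rest = select (f ∘ suc) C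

  tail-empty : (∀ j → par j (contract rest) ≡ false) → ∀ i → i ∉ C
  tail-empty even′ = tree⇒no-even (mapE merge ∘ f ∘ suc) S C (drop-∷-⊆ C⊆S)
    (subst Conn (sym (select-map (mapE merge) (f ∘ suc) S)) (contract-conn conn))
    (trans (cong suc (trans (length-select (mapE merge ∘ f ∘ suc) S) (sym (length-select (f ∘ suc) S)))) (suc-injective len))
    (λ j → trans (cong (par j) (select-map (mapE merge) (f ∘ suc) C)) (even′ j))

  main : ∀ c → (∀ x → par x (select f (c ∷ C)) ≡ false) → ∀ i → i ∉ c ∷ C
  main outside even (suc i) (there i∈C) = tail-empty even′ i i∈C
    where
    even′ : ∀ j → par j (contract rest) ≡ false
    even′ j rewrite par-contract u≢v rest j | even (punchIn u j) | even u = ∧-zeroʳ (δ v (punchIn u j))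
  main inside even i i∈ = contradiction (trans (sym par-u) (cong (par u) rest≡[])) λ()
    where
    cancel : ∀ a b → (true xor a) xor b ≡ false → a ≡ false → b ≡ true
    cancel false true  _ _ = refl
    par-u : par u rest ≡ true
    par-u = cancel (δ v u) (par u rest) (subst (λ b → (b xor δ v u) xor par u rest ≡ false) (δ-refl u) (even u)) (δ-≢ (u≢v ∘ sym))
    cancel′ : ∀ a b c → a ≡ false → (a xor b) xor c ≡ false → c xor (b ∧ true) ≡ false
    cancel′ false true  true  _ _ = refl
    cancel′ false false false _ _ = refl
    even′ : ∀ j → par j (contract rest) ≡ false
    even′ j rewrite par-contract u≢v rest j | par-u =
      cancel′ (δ u (punchIn u j)) _ _ (δ-≢ (punchInᵢ≢i u j ∘ sym)) (even (punchIn u j))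
    rest≡[] : rest ≡ []
    rest≡[] = select-empty (f ∘ suc) C (tail-empty even′)

-- Edges of a tree inside a vertex set

outer : ∀ {n} → (Fin n → Bool) → List (Edge n) → List (Edge n)
outer X = filterᵇ (not ∘ inX X)

length-outer : ∀ {n} (X : Fin n → Bool) es → length (outer X es) + count X es ≡ length es
length-outer X []       = refl
length-outer X (e ∷ es) with inX X e
... | true  = trans (+-suc _ _) (cong suc (length-outer X es))
... | false = cong suc (length-outer X es)

-- Replacing the edges inside X by a star on X keeps a tree connected, so it cannot save edges.
tree-count : ∀ {n} (es : List (Edge n)) → Conn es → suc (length es) ≡ n →
             ∀ X x → X x ≡ true → suc (count X es) ≤ size X
tree-count {n} es conn len X x x∈X =
  ≤-trans (s≤s (+-cancelˡ-≤ (length (outer X es)) _ _ (≤-pred bound))) (≤-reflexive (sym (size-minus X x x∈X)))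
  where
  X-x : Fin n → Bool
  X-x y = not (δ x y) ∧ X y
  star = select (x ,_) (Vec.tabulate X-x)

  length-star : length star ≡ size X-x
  length-star = trans (length-select (x ,_) (Vec.tabulate X-x)) (size-tabulate X-x)

  star-path : ∀ y → X y ≡ true → Path (outer X es ++ star) x y
  star-path y y∈X with x ≟ y
  ... | yes refl = ε
  ... | no x≢y   = adj-path (Any.++⁺ʳ (outer X es) (Any-select⁺ (x ,_) y∈X-x (inj₁ refl)))
    where
    y∈X-x : y ∈ Vec.tabulate X-x
    y∈X-x = lookup⇒[]= y _ (trans (lookup∘tabulate X-x y) (cong₂ (λ a b → not a ∧ b) (δ-≢ x≢y) y∈X))

  inner-path : ∀ {u v} → inX X (u , v) ≡ true → Path (outer X es ++ star) u v
  inner-path {u} {v} uv∈X = path-sym (star-path u (proj₁ (∧-true uv∈X))) ◅◅ star-path v (proj₂ (∧-true uv∈X))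

  reroute : ∀ {e u v} → e List.∈ es → e ≈ (u , v) → Path (outer X es ++ star) u v
  reroute {e} e∈es e≈uv with inX X e in eq
  reroute e∈es (inj₁ refl) | true  = inner-path eq
  reroute e∈es (inj₂ refl) | true  = path-sym (inner-path eq)
  reroute e∈es e≈uv        | false =
    adj-path (Any.++⁺ˡ (lose (∈-filter⁺ _ e∈es (subst (T ∘ not) (sym eq) _)) e≈uv))

  bound : suc (length (outer X es) + count X es) ≤ suc (length (outer X es) + size X-x)
  bound = begin
    suc (length (outer X es) + count X es)       ≡⟨ cong suc (length-outer X es) ⟩
    suc (length es)                              ≡⟨ len ⟩
    n                                            ≤⟨ conn⇒length _ (λ a b → path-map reroute′ (conn a b)) ⟩
    suc (length (outer X es ++ star))            ≡⟨ cong suc (length-++ (outer X es)) ⟩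
    suc (length (outer X es) + length star)      ≡⟨ cong (λ l → suc (length (outer X es) + l)) length-star ⟩
    suc (length (outer X es) + size X-x)         ∎
    where
    open ≤-Reasoning
    reroute′ : ∀ {u v} → Adj es u v → Path (outer X es ++ star) u v
    reroute′ a with e , e∈es , e≈uv ← find a = reroute e∈es e≈uv

-- Cycles

odd : ℕ → Bool
odd zero    = false
odd (suc n) = not (odd n)

odd-+ : ∀ a b → odd (a + b) ≡ odd a xor odd b
odd-+ zero    b = refl
odd-+ (suc a) b rewrite odd-+ a b with odd a
... | true  = not-involutive (odd b)
... | false = refl

odd-𝟙 : ∀ b → odd (𝟙 b) ≡ b
odd-𝟙 true  = refl
odd-𝟙 false = refl

odd-deg : ∀ {n} (x : Fin n) es → odd (deg x es) ≡ par x es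
odd-deg x []             = refl
odd-deg x ((u , v) ∷ es)
  rewrite odd-+ (𝟙 (δ u x) + 𝟙 (δ v x)) (deg x es) | odd-+ (𝟙 (δ u x)) (𝟙 (δ v x))
        | odd-𝟙 (δ u x) | odd-𝟙 (δ v x) | odd-deg x es = refl

sum-select : {A : Set} {k : ℕ} (w : A → ℕ) (f : Fin k → A) (S : Subset k) →
             sum (tabulate (λ i → if does (i ∈? S) then w (f i) else 0)) ≡ total w (select f S)
sum-select w f []            = refl
sum-select w f (inside  ∷ S) = cong (w (f zero) +_) (sum-select w (f ∘ suc) S)
sum-select w f (outside ∷ S) = sum-select w (f ∘ suc) S

degree≡deg : ∀ G S x → degree G S x ≡ deg x (select (ends G) S)
degree≡deg G S x = trans
  (cong sum (map-tabulate id (λ i → if does (i ∈? S) then incidence x (ends G i) else 0)))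
  (sum-select (incidence x) (ends G) S)

cycle-even : ∀ {G C} → IsCycle G C → ∀ x → par x (select (ends G) C) ≡ false
cycle-even {G} {C} (_ , regular , _) x with regular x
... | inj₁ d≡0 = trans (sym (odd-deg x (select (ends G) C))) (cong odd (trans (sym (degree≡deg G C x)) d≡0))
... | inj₂ d≡2 = trans (sym (odd-deg x (select (ends G) C))) (cong odd (trans (sym (degree≡deg G C x)) d≡2))

reach⇒path : ∀ {G S u v} → Reach G S u v → Path (select (ends G) S) u v
reach⇒path     here               = ε
reach⇒path {G} (step i i∈S ij r) = Any-select⁺ (ends G) i∈S ij ◅ reach⇒path r

path⇒reach : ∀ {G S u v} → Path (select (ends G) S) u v → Reach G S u v
path⇒reach         ε       = here
path⇒reach {G} {S} (a ◅ p) with i , i∈S , ij ← Any-select⁻ (ends G) S a = step i i∈S ij (path⇒reach p)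

select-mono : ∀ {k n} (f : Fin k → Edge n) {S S′ : Subset k} → S ⊆ S′ → ∀ {u v} → Path (select f S) u v → Path (select f S′) u v
select-mono f {S} S⊆S′ = path-map λ a →
  let i , i∈S , ij = Any-select⁻ f S a in adj-path (Any-select⁺ f (S⊆S′ i∈S) ij)

⊆-insert : ∀ {k} (p : Subset k) i → p ⊆ p [ i ]≔ inside
⊆-insert p i {x} x∈p with x ≟ i
... | yes refl = []≔-updates p i
... | no x≢i   = []≔-minimal p x i x≢i x∈p

∈-insert⁻ : ∀ {k} (p : Subset k) i {x} → x ∈ p [ i ]≔ inside → x ≡ i ⊎ x ∈ p
∈-insert⁻ p i {x} x∈ with x ≟ i
... | yes x≡i = inj₁ x≡i
... | no x≢i  = inj₂ (lookup⇒[]= x p (trans (sym (lookup∘update′ x≢i p inside)) ([]=⇒lookup x∈)))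

∉-delete : ∀ {k} (p : Subset k) i → i ∉ p [ i ]≔ outside
∉-delete p i i∈ = contradiction (trans (sym ([]=⇒lookup i∈)) (lookup∘update i p outside)) λ()

∈-delete⁻ : ∀ {k} (p : Subset k) i {x} → x ∈ p [ i ]≔ outside → x ∈ p
∈-delete⁻ p i {x} x∈ with x ≟ i
... | yes refl = contradiction x∈ (∉-delete p x)
... | no x≢i   = lookup⇒[]= x p (trans (sym (lookup∘update′ x≢i p outside)) ([]=⇒lookup x∈))

∉⇒lookup : ∀ {k} {p : Subset k} {x} → x ∉ p → Vec.lookup p x ≡ false
∉⇒lookup {p = p} {x} x∉p with Vec.lookup p x in eq
... | true  = contradiction (lookup⇒[]= x p eq) x∉p
... | false = refl

≈-endpoint : ∀ {n} {e : Edge n} {u w x y} → e ≈ (u , w) → e ≈ (x , y) → x ≡ u ⊎ x ≡ w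
≈-endpoint (inj₁ refl) (inj₁ refl) = inj₁ refl
≈-endpoint (inj₁ refl) (inj₂ refl) = inj₂ refl
≈-endpoint (inj₂ refl) (inj₁ refl) = inj₂ refl
≈-endpoint (inj₂ refl) (inj₂ refl) = inj₁ refl

module _ (G : Graph) where

  private
    sel : EdgeSet G → List (Edge (V G))
    sel = select (ends G)

  -- The indices record the edges and the vertices of the path. The condition `u ∉ W` makes every
  -- step add a new vertex and a new edge, so that degrees can be read off.
  data SimplePath (S : EdgeSet G) : Fin (V G) → Fin (V G) → EdgeSet G → Subset (V G) → Set where
    nil  : ∀ {v} → SimplePath S v v ⊥ (⊥ [ v ]≔ inside)
    cons : ∀ {u w v C W} i → i ∈ S → Joins G i u w → u ∉ W → SimplePath S w v C W →
           SimplePath S u v (C [ i ]≔ inside) (W [ u ]≔ inside)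

  module _ {S : EdgeSet G} where

    sp-edges : ∀ {u v C W} → SimplePath S u v C W → C ⊆ S
    sp-edges nil i∈⊥ = contradiction i∈⊥ ∉⊥
    sp-edges (cons {C = C} i i∈S _ _ p) j∈ with ∈-insert⁻ C i j∈
    ... | inj₁ refl = i∈S
    ... | inj₂ j∈C  = sp-edges p j∈C

    sp-start : ∀ {u v C W} → SimplePath S u v C W → u ∈ W
    sp-start nil                        = []≔-updates ⊥ _
    sp-start (cons {W = W} i _ _ _ _) = []≔-updates W _

    sp-end : ∀ {u v C W} → SimplePath S u v C W → v ∈ W
    sp-end nil                        = []≔-updates ⊥ _
    sp-end (cons {W = W} i _ _ _ p) = ⊆-insert W _ (sp-end p)

    sp-incident : ∀ {u v C W} → SimplePath S u v C W → ∀ {j x y} → j ∈ C → Joins G j x y → x ∈ W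
    sp-incident nil j∈ jx = contradiction j∈ ∉⊥
    sp-incident (cons {C = C} {W} i _ iu _ p) j∈ jx with ∈-insert⁻ C i j∈
    ... | inj₂ j∈C  = ⊆-insert W _ (sp-incident p j∈C jx)
    ... | inj₁ refl with ≈-endpoint iu jx
    ...   | inj₁ refl = []≔-updates W _
    ...   | inj₂ refl = ⊆-insert W _ (sp-start p)

    sp-path : ∀ {u v C W} → SimplePath S u v C W → ∀ {x} → x ∈ W → Path (sel C) x v
    sp-path (nil {v}) x∈ with ∈-insert⁻ ⊥ v x∈
    ... | inj₁ refl = ε
    ... | inj₂ x∈⊥  = contradiction x∈⊥ ∉⊥
    sp-path (cons {u = u} {C = C} {W} i _ iu _ p) x∈ with ∈-insert⁻ W u x∈
    ... | inj₁ refl = Any-select⁺ (ends G) ([]≔-updates C i) iu ◅ select-mono (ends G) (⊆-insert C i) (sp-path p (sp-start p))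
    ... | inj₂ x∈W  = select-mono (ends G) (⊆-insert C i) (sp-path p x∈W)

    -- The terms for `u` and `v` are the contribution of an edge that closes the path: the closed
    -- path has degree 2 on `W` and 0 elsewhere. For `nil` the closing edge is a loop.
    sp-degree : ∀ {u v C W} → SimplePath S u v C W → ∀ x →
                deg x (sel C) + (𝟙 (δ u x) + 𝟙 (δ v x)) ≡ 2 * 𝟙 (Vec.lookup W x)
    sp-degree (nil {v}) x rewrite select-empty (ends G) ⊥ (λ _ → ∉⊥) with v ≟ x
    ... | yes refl rewrite lookup∘update v (⊥ {V G}) inside = refl
    ... | no v≢x   rewrite lookup∘update′ (v≢x ∘ sym) ⊥ inside | ∉⇒lookup (∉⊥ {x = x}) = refl
    sp-degree (cons {u} {w} {v} {C} {W} i _ iu u∉W p) x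
      rewrite total-select-insert (incidence x) (ends G) (λ i∈C → u∉W (sp-incident p i∈C iu))
            | incidence-≈ x iu =
      trans (regroup (𝟙 (δ u x)) (𝟙 (δ w x)) (deg x (sel C)) (𝟙 (δ v x)))
            (trans (cong (2 * 𝟙 (δ u x) +_) (sp-degree p x)) new-vertex)
      where
      regroup : ∀ a b d c → a + b + d + (a + c) ≡ 2 * a + (d + (b + c))
      regroup = solve 4 (λ a b d c → a :+ b :+ d :+ (a :+ c) := con 2 :* a :+ (d :+ (b :+ c))) refl
        where open +-*-Solver
      new-vertex : 2 * 𝟙 (δ u x) + 2 * 𝟙 (Vec.lookup W x) ≡ 2 * 𝟙 (Vec.lookup (W [ u ]≔ inside) x)
      new-vertex with u ≟ x
      ... | yes refl rewrite lookup∘update u W inside | ∉⇒lookup u∉W = refl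
      ... | no u≢x   rewrite lookup∘update′ (u≢x ∘ sym) W inside = refl

    sp-suffix : ∀ {u v C W} → SimplePath S u v C W → ∀ {x} → x ∈ W → ∃[ C′ ] ∃[ W′ ] SimplePath S x v C′ W′
    sp-suffix (nil {v}) x∈ with ∈-insert⁻ ⊥ v x∈
    ... | inj₁ refl = _ , _ , nil
    ... | inj₂ x∈⊥  = contradiction x∈⊥ ∉⊥
    sp-suffix q@(cons {u = u} {W = W} i _ _ _ p) x∈ with ∈-insert⁻ W u x∈
    ... | inj₁ refl = _ , _ , q
    ... | inj₂ x∈W  = sp-suffix p x∈W

    simplify : ∀ {u v} → Path (sel S) u v → ∃[ C ] ∃[ W ] SimplePath S u v C W
    simplify ε = _ , _ , nil
    simplify {u} (a ◅ p) with simplify p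
    ... | C , W , q with u ∈? W
    ...   | yes u∈W = sp-suffix q u∈W
    ...   | no u∉W  with i , i∈S , iu ← Any-select⁻ (ends G) S a = _ , _ , cons i i∈S iu u∉W q

  -- A simple path in `S` between the ends of `i` is closed by `i`. As `i ∉ S`, the closing edge is
  -- not yet on the path, so inserting it adds its incidences once.
  cycle-through : ∀ S i → i ∉ S → Path (sel S) (proj₁ (ends G i)) (proj₂ (ends G i)) →
                  ∃[ C ] IsCycle G C × i ∈ C × (∀ {j} → j ∈ C → j ≡ i ⊎ j ∈ S)
  cycle-through S i i∉S path with C , W , p ← simplify path =
    C⁺ , ((i , i∈C⁺) , regular , λ x y x∈ y∈ → path⇒reach (to-end x x∈ ◅◅ path-sym (to-end y y∈))) , i∈C⁺ , C⁺⊆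
    where
    C⁺ = C [ i ]≔ inside
    i∈C⁺ = []≔-updates C i

    C⁺⊆ : ∀ {j} → j ∈ C⁺ → j ≡ i ⊎ j ∈ S
    C⁺⊆ j∈ = Sum.map₂ (sp-edges p) (∈-insert⁻ C i j∈)

    double : ∀ b {d} → d ≡ 2 * 𝟙 b → d ≡ 0 ⊎ d ≡ 2
    double false = inj₁
    double true  = inj₂

    regular : ∀ x → degree G C⁺ x ≡ 0 ⊎ degree G C⁺ x ≡ 2
    regular x = double (Vec.lookup W x) (trans (degree≡deg G C⁺ x)
      (trans (total-select-insert (incidence x) (ends G) (i∉S ∘ sp-edges p))
      (trans (+-comm (incidence x (ends G i)) _) (sp-degree p x))))

    incident∈W : ∀ x → Incident G x C⁺ → x ∈ W
    incident∈W x (j , j∈ , y , jx) with ∈-insert⁻ C i j∈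
    ... | inj₂ j∈C  = sp-incident p j∈C jx
    ... | inj₁ refl with ≈-endpoint (inj₁ refl) jx
    ...   | inj₁ refl = sp-start p
    ...   | inj₂ refl = sp-end p

    to-end : ∀ x → Incident G x C⁺ → Path (sel C⁺) x (proj₂ (ends G i))
    to-end x x∈ = select-mono (ends G) (⊆-insert C i) (sp-path p (incident∈W x x∈))

-- Symmetric differences of edge sets

infixl 6 _△_

_△_ : ∀ {k} → Subset k → Subset k → Subset k
_△_ = Vec.zipWith _xor_

par-△ : ∀ {k n} (f : Fin k → Edge n) (C D : Subset k) x →
        par x (select f (C △ D)) ≡ par x (select f C) xor par x (select f D)
par-△ f []            []            x = refl
par-△ f (inside  ∷ C) (inside  ∷ D) x =
  trans (par-△ (f ∘ suc) C D x) (cancel (δ (proj₁ (f zero)) x xor δ (proj₂ (f zero)) x) _ _)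
  where
  cancel : ∀ a b c → b xor c ≡ (a xor b) xor (a xor c)
  cancel false b     c = refl
  cancel true  false c = sym (not-involutive c)
  cancel true  true  c = refl
par-△ f (inside  ∷ C) (outside ∷ D) x =
  trans (cong (at-head xor_) (par-△ (f ∘ suc) C D x)) (sym (xor-assoc at-head _ _))
  where at-head = δ (proj₁ (f zero)) x xor δ (proj₂ (f zero)) x
par-△ f (outside ∷ C) (inside  ∷ D) x =
  trans (cong (at-head xor_) (par-△ (f ∘ suc) C D x)) (exchange at-head (par x (select (f ∘ suc) C)) _)
  where
  at-head = δ (proj₁ (f zero)) x xor δ (proj₂ (f zero)) x
  exchange : ∀ a b c → a xor (b xor c) ≡ b xor (a xor c)
  exchange a b c = trans (sym (xor-assoc a b c)) (trans (cong (_xor c) (xor-comm a b)) (xor-assoc b a c))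
par-△ f (outside ∷ C) (outside ∷ D) x = par-△ (f ∘ suc) C D x

△-empty : ∀ {k} (C D : Subset k) → (∀ i → i ∉ C △ D) → C ≡ D
△-empty []            []            empty = refl
△-empty (inside  ∷ C) (inside  ∷ D) empty = cong (inside ∷_) (△-empty C D λ i → empty (suc i) ∘ there)
△-empty (inside  ∷ C) (outside ∷ D) empty = contradiction here (empty zero)
△-empty (outside ∷ C) (inside  ∷ D) empty = contradiction here (empty zero)
△-empty (outside ∷ C) (outside ∷ D) empty = cong (outside ∷_) (△-empty C D λ i → empty (suc i) ∘ there)

-- The common edge `i` cancels.
△-⊆ : ∀ {k} {C D S : Subset k} i → C ⊆ S → D ⊆ S → i ∈ C → i ∈ D → C △ D ⊆ S [ i ]≔ outside
△-⊆ {C = C} {D} {S} i C⊆S D⊆S i∈C i∈D {j} j∈ with j ≟ i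
... | yes refl = contradiction
        (trans (sym ([]=⇒lookup j∈)) (trans (lookup-zipWith _xor_ j C D) (cong₂ _xor_ ([]=⇒lookup i∈C) ([]=⇒lookup i∈D)))) λ()
... | no j≢i with j ∈? C | j ∈? D
...   | yes j∈C | _       = []≔-minimal S j i j≢i (C⊆S j∈C)
...   | no _    | yes j∈D = []≔-minimal S j i j≢i (D⊆S j∈D)
...   | no j∉C  | no j∉D  = contradiction
        (trans (sym ([]=⇒lookup j∈)) (trans (lookup-zipWith _xor_ j C D) (cong₂ _xor_ (∉⇒lookup j∉C) (∉⇒lookup j∉D)))) λ()

-- Trees and connected unicyclic graphs by their number of edges

TreeMapCount : Graph → Set
TreeMapCount G = Σ[ T ∈ EdgeSet G ]
  (Conn (sel T) × suc (length (sel T)) ≡ V G) × (Conn (sel (∁ T)) × length (sel (∁ T)) ≡ V G)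
  where sel = select (ends G)

module _ {G : Graph} where

  private
    sel : EdgeSet G → List (Edge (V G))
    sel = select (ends G)

    Redundant : EdgeSet G → EdgeIx G → Set
    Redundant S i = i ∈ S × Path (sel (S [ i ]≔ outside)) (proj₁ (ends G i)) (proj₂ (ends G i))

  length-delete : ∀ {S i} → i ∈ S → length (sel S) ≡ suc (length (sel (S [ i ]≔ outside)))
  length-delete {S} {i} i∈S =
    trans (sym (total-1 (sel S))) (trans (total-select-delete (λ _ → 1) (ends G) i∈S) (cong suc (total-1 (sel (S [ i ]≔ outside)))))

  conn-delete : ∀ {S i} → Redundant S i → Conn (sel S) → Conn (sel (S [ i ]≔ outside))
  conn-delete {S} {i} (i∈S , p) conn a b = path-map bypass (conn a b)
    where
    bypass : ∀ {u w} → Adj (sel S) u w → Path (sel (S [ i ]≔ outside)) u w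
    bypass a with Any-select⁻ (ends G) S a
    ... | j , j∈S , ju with j ≟ i
    ...   | no j≢i = adj-path (Any-select⁺ (ends G) ([]≔-minimal S j i j≢i j∈S) ju)
    bypass a | j , j∈S , inj₁ refl | yes refl = p
    bypass a | j , j∈S , inj₂ refl | yes refl = path-sym p

  redundant⇒cycle : ∀ {S i} → Redundant S i → ∃[ C ] C ⊆ S × IsCycle G C × i ∈ C
  redundant⇒cycle {S} {i} (i∈S , p) with C , cyc , i∈C , C⊆ ← cycle-through G (S [ i ]≔ outside) i (∉-delete S i) p =
    C , (λ j∈C → Sum.[ (λ where refl → i∈S) , ∈-delete⁻ S i ] (C⊆ j∈C)) , cyc , i∈C

  tree⇒acyclic : ∀ S → Conn (sel S) → suc (length (sel S)) ≡ V G → Acyclic G S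
  tree⇒acyclic S conn len C C⊆S cyc@((i , i∈C) , _) = tree⇒no-even (ends G) S C C⊆S conn len (cycle-even cyc) i i∈C

  -- Deleting a redundant edge `i` turns `M` into a tree, so every cycle of `M` runs through `i`.
  treeMapCount⇒decomposition : TreeMapCount G → TreeMapDecomposition G
  treeMapCount⇒decomposition (T , (connT , lenT) , connM , lenM)
    with i , redundant ← redundant-edge (ends G) (∁ T) (subst Fin lenT zero) (≤-reflexive (sym lenM))
    with C , C⊆M , cyc , i∈C ← redundant⇒cycle redundant =
    T , ((λ u v → path⇒reach (connT u v)) , tree⇒acyclic T connT lenT) ,
        (λ u v → path⇒reach (connM u v)) , C , C⊆M , cyc , unique
    where
    M = ∁ T
    M-i = M [ i ]≔ outside

    connM-i : Conn (sel M-i)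
    connM-i = conn-delete redundant connM

    lenM-i : suc (length (sel M-i)) ≡ V G
    lenM-i = trans (sym (length-delete (proj₁ redundant))) lenM

    through-i : ∀ {C′} → C′ ⊆ M → IsCycle G C′ → i ∈ C′
    through-i {C′} C′⊆M cyc′ with i ∈? C′
    ... | yes i∈C′ = i∈C′
    ... | no i∉C′  = contradiction cyc′ (tree⇒acyclic M-i connM-i lenM-i C′
                       λ {j} j∈C′ → []≔-minimal M j i (λ where refl → i∉C′ j∈C′) (C′⊆M j∈C′))

    -- The symmetric difference of two cycles of M through i is an even subset of the tree M - i.
    unique : ∀ C′ → C′ ⊆ M → IsCycle G C′ → C′ ≡ C
    unique C′ C′⊆M cyc′ = △-empty C′ C (tree⇒no-even (ends G) M-i (C′ △ C)
      (△-⊆ i C′⊆M C⊆M (through-i C′⊆M cyc′) i∈C) connM-i lenM-i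
      λ x → trans (par-△ (ends G) C′ C x) (cong₂ _xor_ (cycle-even cyc′ x) (cycle-even cyc x)))

  -- A redundant edge of `T` would close a cycle, so `T` has fewer than |V| edges. `M` has at least
  -- |V| edges, since with |V| - 1 it would be a tree containing the cycle `C`.
  decomposition⇒treeMapCount : TreeMapDecomposition G → TreeMapCount G
  decomposition⇒treeMapCount (T , (connT , acyclic) , connM , C , C⊆M , cyc@((i , i∈C) , _) , unique) =
    T , (connT′ , ≤-antisym (≰⇒> lenT≱) (conn⇒length (sel T) connT′)) ,
        connM′ , ≤-antisym (≮⇒≥ lenM≯) (≤-pred (≤∧≢⇒< (conn⇒length (sel M) connM′) lenM≢))
    where
    M = ∁ T
    x = proj₁ (ends G i)
    connT′ : Conn (sel T)
    connT′ u v = reach⇒path (connT u v)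
    connM′ : Conn (sel M)
    connM′ u v = reach⇒path (connM u v)

    lenT≱ : ¬ V G ≤ length (sel T)
    lenT≱ V≤ with j , redundant ← redundant-edge (ends G) T x V≤
             with C′ , C′⊆T , cyc′ , _ ← redundant⇒cycle redundant = acyclic C′ C′⊆T cyc′

    lenM≢ : V G ≢ suc (length (sel M))
    lenM≢ eq = tree⇒acyclic M connM′ (sym eq) C C⊆M cyc

    -- Given more than |V| edges, remove a redundant edge `j` of `M` and find another one in what is
    -- left. The first closes a cycle through `j`, the second a cycle avoiding `j`, against
    -- uniqueness.
    lenM≯ : ¬ V G < length (sel M)
    lenM≯ V< with j , r@(j∈M , _) ← redundant-edge (ends G) M x (<⇒≤ V<)
             with k , s ← redundant-edge (ends G) (M [ j ]≔ outside) x (≤-pred (≤-trans V< (≤-reflexive (length-delete j∈M))))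
             with C₁ , C₁⊆M , cyc₁ , j∈C₁ ← redundant⇒cycle r | C₂ , C₂⊆ , cyc₂ , _ ← redundant⇒cycle s =
      ∉-delete M j (C₂⊆ (subst (j ∈_) (trans (unique C₁ C₁⊆M cyc₁) (sym (unique C₂ (∈-delete⁻ M j ∘ C₂⊆) cyc₂))) j∈C₁))

-- (2,2)-tight edge lists

-- Sparsity is stated for all edges induced by a vertex set, the largest choice of `E'`. Ranging
-- over nonempty vertex sets changes nothing, as an edgeless one satisfies 2 ≤ 2|X|.
record Tight22 (n : ℕ) (es : List (Edge n)) : Set where
  constructor tight22
  field
    length-eq : length es + 2 ≡ 2 * n
    sparse    : ∀ X x → X x ≡ true → count X es + 2 ≤ 2 * size X
open Tight22

total-select-≤ : {A : Set} {k : ℕ} (w : A → ℕ) (f : Fin k → A) (S : Subset k) → total w (select f S) ≤ total w (tabulate f)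
total-select-≤ w f S = ≤-trans (m≤m+n _ _) (≤-reflexive (total-select-∁ w f S))

spanned-count : ∀ G (V′ : Subset (V G)) (E′ : EdgeSet G) →
                (∀ i → i ∈ E′ → (proj₁ (ends G i) ∈ V′) × (proj₂ (ends G i) ∈ V′)) →
                ∣ E′ ∣ ≤ count (Vec.lookup V′) (E G)
spanned-count G V′ E′ spanned = begin
  ∣ E′ ∣                                        ≡⟨ length-select (ends G) E′ ⟨
  length (select (ends G) E′)                   ≡⟨ all-inside (ends G) E′ (λ i i∈ → Product.map []=⇒lookup []=⇒lookup (spanned i i∈)) ⟨
  count X (select (ends G) E′)                  ≤⟨ total-select-≤ _ (ends G) E′ ⟩
  count X (tabulate (lookup (E G)))             ≡⟨ cong (count X) (tabulate-lookup (E G)) ⟩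
  count X (E G)                                 ∎
  where
  open ≤-Reasoning
  X = Vec.lookup V′
  all-inside : ∀ {k} (f : Fin k → Edge (V G)) (S : Subset k) →
               (∀ i → i ∈ S → X (proj₁ (f i)) ≡ true × X (proj₂ (f i)) ≡ true) →
               count X (select f S) ≡ length (select f S)
  all-inside f []            h = refl
  all-inside f (outside ∷ S) h = all-inside (f ∘ suc) S (λ i → h (suc i) ∘ there)
  all-inside f (inside  ∷ S) h =
    cong₂ _+_ (cong₂ (λ a b → 𝟙 (a ∧ b)) (proj₁ (h zero here)) (proj₂ (h zero here))) (all-inside (f ∘ suc) S (λ i → h (suc i) ∘ there))

tight22⇒P21 : ∀ G e → Tight22 (V G) (removeAt (E G) e) → P21 G
tight22⇒P21 G e t = (sparse21 , tight21) , e , sparse22 , length-eq t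
  where
  es = removeAt (E G) e

  𝟙≤1 : ∀ b → 𝟙 b ≤ 1
  𝟙≤1 true  = s≤s z≤n
  𝟙≤1 false = z≤n

  sparse22 : Sparse 2 2 (deleteEdge G e)
  sparse22 V′ E′ (i , i∈E′) spanned = begin
    ∣ E′ ∣ + 2                      ≤⟨ +-monoˡ-≤ 2 (spanned-count (deleteEdge G e) V′ E′ spanned) ⟩
    count (Vec.lookup V′) es + 2    ≤⟨ sparse t (Vec.lookup V′) _ ([]=⇒lookup (proj₁ (spanned i i∈E′))) ⟩
    2 * size (Vec.lookup V′)        ≡⟨ cong (2 *_) (size-lookup V′) ⟨
    2 * ∣ V′ ∣                      ∎
    where open ≤-Reasoning

  sparse21 : Sparse 2 1 G
  sparse21 V′ E′ (i , i∈E′) spanned = begin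
    ∣ E′ ∣ + 1                              ≤⟨ +-monoˡ-≤ 1 (spanned-count G V′ E′ spanned) ⟩
    count X (E G) + 1                       ≡⟨ cong (_+ 1) (total-removeAt (𝟙 ∘ inX X) (E G) e) ⟩
    𝟙 (inX X (lookup (E G) e)) + count X es + 1 ≤⟨ +-monoˡ-≤ 1 (+-monoˡ-≤ (count X es) (𝟙≤1 (inX X (lookup (E G) e)))) ⟩
    1 + count X es + 1                      ≡⟨ +-suc (count X es) 1 ⟨
    count X es + 2                          ≤⟨ sparse t X _ ([]=⇒lookup (proj₁ (spanned i i∈E′))) ⟩
    2 * size X                              ≡⟨ cong (2 *_) (size-lookup V′) ⟨
    2 * ∣ V′ ∣                              ∎
    where
    open ≤-Reasoning
    X = Vec.lookup V′

  tight21 : length (E G) + 1 ≡ 2 * V G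
  tight21 = trans (cong (_+ 1) (length-removeAt′ (E G) e)) (trans (sym (+-suc (length es) 1)) (length-eq t))

P21⇒tight22 : ∀ G (p : P21 G) → Tight22 (V G) (removeAt (E G) (proj₁ (proj₂ p)))
P21⇒tight22 G (_ , e , sp , len) = tight22 len bound
  where
  es = removeAt (E G) e

  bound : ∀ X x → X x ≡ true → count X es + 2 ≤ 2 * size X
  bound X x x∈X with nonempty? E′
    where
    E′ = Vec.tabulate (inX X ∘ lookup es)
  ... | yes ne = subst₂ (λ a b → a + 2 ≤ 2 * b) (trans (size-tabulate (inX X ∘ lookup es)) (∑-total es)) (size-tabulate X)
                   (sp (Vec.tabulate X) _ ne spanned)
    where
    ∑-total : ∀ es → size (inX X ∘ lookup es) ≡ count X es
    ∑-total []       = refl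
    ∑-total (e ∷ es) = cong (𝟙 (inX X e) +_) (∑-total es)

    ∈X : ∀ {y} → X y ≡ true → y ∈ Vec.tabulate X
    ∈X {y} eq = lookup⇒[]= y _ (trans (lookup∘tabulate X y) eq)

    spanned : ∀ i → i ∈ Vec.tabulate (inX X ∘ lookup es) →
              (proj₁ (lookup es i) ∈ Vec.tabulate X) × (proj₂ (lookup es i) ∈ Vec.tabulate X)
    spanned i i∈ = Product.map ∈X ∈X (∧-true (trans (sym (lookup∘tabulate (inX X ∘ lookup es) i)) ([]=⇒lookup i∈)))
  ... | no empty = ≤-trans (≤-reflexive (cong (_+ 2) count≡0)) (*-monoʳ-≤ 2 (≤-trans (s≤s z≤n) (≤-reflexive (sym (size-minus X x x∈X)))))
    where
    none : ∀ es → (∀ i → inX X (lookup es i) ≡ false) → count X es ≡ 0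
    none []       h = refl
    none (e ∷ es) h rewrite h zero = none es (h ∘ suc)
    count≡0 : count X es ≡ 0
    count≡0 = none es λ i → trans (sym (lookup∘tabulate (inX X ∘ lookup es) i)) (∉⇒lookup (λ i∈ → empty (i , i∈)))

treeMapCount⇒P21 : ∀ {G} → TreeMapCount G → P21 G
treeMapCount⇒P21 {G} (T , (connT , lenT) , connM , lenM)
  with i , r@(i∈M , _) ← redundant-edge (ends G) (∁ T) (subst Fin lenT zero) (≤-reflexive (sym lenM)) =
  tight22⇒P21 G i (tight22 (arith _ _ _ _ lengths lenT lenM-i) bound)
  where
  sel = select (ends G)
  M-i = ∁ T [ i ]≔ outside

  lenM-i : suc (length (sel M-i)) ≡ V G
  lenM-i = trans (sym (length-delete {G} i∈M)) lenM

  -- Used with weight 1 for the number of edges and with the indicator of `X` for the edges inside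
  -- `X`.
  totals : ∀ w → total w (removeAt (E G) i) ≡ total w (sel T) + total w (sel M-i)
  totals w = +-cancelˡ-≡ (w (lookup (E G) i)) _ _ (begin
    w (lookup (E G) i) + total w (removeAt (E G) i)              ≡⟨ total-removeAt w (E G) i ⟨
    total w (E G)                                                ≡⟨ cong (total w) (tabulate-lookup (E G)) ⟨
    total w (tabulate (lookup (E G)))                            ≡⟨ total-select-∁ w (ends G) T ⟨
    total w (sel T) + total w (sel (∁ T))                        ≡⟨ cong (total w (sel T) +_) (total-select-delete w (ends G) i∈M) ⟩
    total w (sel T) + (w (lookup (E G) i) + total w (sel M-i))   ≡⟨ x∙yz≈y∙xz (total w (sel T)) (w (lookup (E G) i)) _ ⟩
    w (lookup (E G) i) + (total w (sel T) + total w (sel M-i))   ∎)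
    where open ≡-Reasoning

  lengths : length (removeAt (E G) i) ≡ length (sel T) + length (sel M-i)
  lengths = trans (sym (total-1 (removeAt (E G) i))) (trans (totals (λ _ → 1)) (cong₂ _+_ (total-1 (sel T)) (total-1 (sel M-i))))

  arith : ∀ l a b n → l ≡ a + b → suc a ≡ n → suc b ≡ n → l + 2 ≡ 2 * n
  arith l a b n refl refl eq rewrite suc-injective eq =
    +-*-Solver.solve 1 (λ a → a :+ a :+ con 2 := con 2 :* (con 1 :+ a)) refl a
    where open +-*-Solver

  bound : ∀ X x → X x ≡ true → count X (removeAt (E G) i) + 2 ≤ 2 * size X
  bound X x x∈X = begin
    count X (removeAt (E G) i) + 2                     ≡⟨ cong (_+ 2) (totals _) ⟩
    count X (sel T) + count X (sel M-i) + 2            ≡⟨ regroup (count X (sel T)) _ ⟩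
    suc (count X (sel T)) + suc (count X (sel M-i))    ≤⟨ +-mono-≤ (tree-count _ connT lenT X x x∈X)
                                                                    (tree-count _ (conn-delete {G} r connM) lenM-i X x x∈X) ⟩
    size X + size X                                    ≡⟨ cong (size X +_) (+-identityʳ (size X)) ⟨
    2 * size X                                         ∎
    where
    open ≤-Reasoning
    regroup : ∀ a b → a + b + 2 ≡ suc a + suc b
    regroup = +-*-Solver.solve 2 (λ a b → a :+ b :+ con 2 := con 1 :+ a :+ (con 1 :+ b)) refl
      where open +-*-Solver

-- Transport of decompositions along permutations of the edge list

conn-↭ : ∀ {n} {es es′ : List (Edge n)} → es ↭ es′ → Conn es → Conn es′
conn-↭ p conn u v = path-map (adj-path ∘ Any-resp-↭ (λ e≈f e≈ → ≈-trans (≈-sym e≈f) e≈) p) (conn u v)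

select-∷-↭ : ∀ {n} {e e′ : Edge n} {es es′} s {S : Subset (length es)} {S′ : Subset (length es′)} → e ≈ e′ →
             select (lookup es) S ↭ select (lookup es′) S′ →
             select (lookup (e ∷ es)) (s ∷ S) ↭ select (lookup (e′ ∷ es′)) (s ∷ S′)
select-∷-↭ inside  e≈e′ p = Homogeneous.prep e≈e′ p
select-∷-↭ outside e≈e′ p = p

select-swap-↭ : ∀ {n} (e f : Edge n) es s t (S : Subset (length es)) →
                select (lookup (e ∷ f ∷ es)) (s ∷ t ∷ S) ↭ select (lookup (f ∷ e ∷ es)) (t ∷ s ∷ S)
select-swap-↭ e f es inside  inside  S = ↭-swap e f ↭-refl
select-swap-↭ e f es inside  outside S = ↭-refl
select-swap-↭ e f es outside inside  S = ↭-refl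
select-swap-↭ e f es outside outside S = ↭-refl

-- Positions are carried backwards along the permutation. The complement travels in the same
-- recursion, so that one subset transports both parts of a decomposition.
select-↭ : ∀ {n} {es es′ : List (Edge n)} → es ↭ es′ → (S′ : Subset (length es′)) →
           Σ[ S ∈ Subset (length es) ]
             (select (lookup es) S     ↭ select (lookup es′) S′) ×
             (select (lookup es) (∁ S) ↭ select (lookup es′) (∁ S′))
select-↭ (Homogeneous.refl [])          []       = [] , ↭-refl , ↭-refl
select-↭ (Homogeneous.refl (e≈ ∷ eqs))  (s ∷ S′) with S , p , q ← select-↭ (Homogeneous.refl eqs) S′ =
  s ∷ S , select-∷-↭ s e≈ p , select-∷-↭ (not s) e≈ q
select-↭ (Homogeneous.prep e≈ π)        (s ∷ S′) with S , p , q ← select-↭ π S′ =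
  s ∷ S , select-∷-↭ s e≈ p , select-∷-↭ (not s) e≈ q
select-↭ (Homogeneous.swap {xs} {ys} {x} {y} {x′} {y′} x≈ y≈ π) (s ∷ t ∷ S′) with S , p , q ← select-↭ π S′ =
  t ∷ s ∷ S ,
  ↭-trans (select-swap-↭ x y xs t s S) (select-∷-↭ s {t ∷ S} {t ∷ S′} y≈ (select-∷-↭ t x≈ p)) ,
  ↭-trans (select-swap-↭ x y xs (not t) (not s) (∁ S))
          (select-∷-↭ (not s) {not t ∷ ∁ S} {not t ∷ ∁ S′} y≈ (select-∷-↭ (not t) x≈ q))
select-↭ (Homogeneous.trans π ρ)        S″       with S′ , p′ , q′ ← select-↭ ρ S″ with S , p , q ← select-↭ π S′ =
  S , ↭-trans p p′ , ↭-trans q q′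

select-⊥ : {A : Set} (xs : List A) → select (lookup xs) ⊥ ≡ [] × select (lookup xs) (∁ ⊥) ≡ xs
select-⊥ []       = refl , refl
select-⊥ (x ∷ xs) = proj₁ (select-⊥ xs) , cong (x ∷_) (proj₂ (select-⊥ xs))

select-prefix : {A : Set} (xs ys : List A) → Σ[ S ∈ Subset (length (xs ++ ys)) ]
                select (lookup (xs ++ ys)) S ≡ xs × select (lookup (xs ++ ys)) (∁ S) ≡ ys
select-prefix []       ys = ⊥ , select-⊥ ys
select-prefix (x ∷ xs) ys with S , p , q ← select-prefix xs ys = inside ∷ S , cong (x ∷_) p , q

select-∁-↭ : ∀ {k n} (f : Fin k → Edge n) (S : Subset k) → tabulate f ↭ select f S ++ select f (∁ S)
select-∁-↭ f []            = ↭-refl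
select-∁-↭ f (inside  ∷ S) = ↭-prep (f zero) (select-∁-↭ (f ∘ suc) S)
select-∁-↭ f (outside ∷ S) = ↭-trans (↭-prep (f zero) (select-∁-↭ (f ∘ suc) S)) (↭-sym (↭-shift (select (f ∘ suc) S) _))

select-delete-↭ : ∀ {k n} (f : Fin k → Edge n) {S : Subset k} {i} → i ∈ S → select f S ↭ f i ∷ select f (S [ i ]≔ outside)
select-delete-↭ f               here        = ↭-refl
select-delete-↭ f {inside  ∷ S} (there i∈S) = ↭-trans (↭-prep (f zero) (select-delete-↭ (f ∘ suc) i∈S)) (↭-swap (f zero) _ ↭-refl)
select-delete-↭ f {outside ∷ S} (there i∈S) = select-delete-↭ (f ∘ suc) i∈S

-- Moves preserve the decomposition

-- Two lists take the place of an index set and its complement: a move deletes and appends edges and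
-- so shifts indices, to which `_↭_` is insensitive.
record TreeMapSplit (n : ℕ) (es : List (Edge n)) : Set where
  constructor split
  field
    tree cyc  : List (Edge n)
    es↭       : es ↭ tree ++ cyc
    conn-tree : Conn tree
    conn-cyc  : Conn cyc
    length-tree : suc (length tree) ≡ n
    length-cyc  : length cyc ≡ n

split⇒treeMapCount : ∀ {G} → TreeMapSplit (V G) (E G) → TreeMapCount G
split⇒treeMapCount (split a b es↭ conn-a conn-b len-a len-b)
  with S′ , ≡a , ≡b ← select-prefix a b
  with S , p , q ← select-↭ es↭ S′
  with p ← ↭-trans p (↭-reflexive ≡a) | q ← ↭-trans q (↭-reflexive ≡b) =
  S , (conn-↭ (↭-sym p) conn-a , trans (cong suc (xs↭ys⇒|xs|≡|ys| p)) len-a) ,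
      (conn-↭ (↭-sym q) conn-b , trans (xs↭ys⇒|xs|≡|ys| q) len-b)

select-split : ∀ G S → E G ↭ select (ends G) S ++ select (ends G) (∁ S)
select-split G S = subst (_↭ select (ends G) S ++ select (ends G) (∁ S)) (tabulate-lookup (E G)) (select-∁-↭ (ends G) S)

treeMapCount⇒split : ∀ {G} → TreeMapCount G → TreeMapSplit (V G) (E G)
treeMapCount⇒split {G} (T , (connT , lenT) , connM , lenM) = split _ _ (select-split G T) connT connM lenT lenM

hub⇒conn : ∀ {n} {es : List (Edge (suc n))} {v} → (∀ u w → Path es (inject₁ u) (inject₁ w)) →
           Path es (fromℕ n) (inject₁ v) → Conn es
hub⇒conn {n} {es} {v} old new x y = path-sym (to-v x) ◅◅ to-v y
  where
  to-v : ∀ x → Path es (inject₁ v) x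
  to-v x with view x
  ... | ‵fromℕ     = path-sym new
  ... | ‵inject₁ u = old v u

adj-liftE : ∀ {n} {es : List (Edge n)} {u w} → Adj es u w → Adj (liftE es) (inject₁ u) (inject₁ w)
adj-liftE a = Any.map⁺ (Any.map (mapE-≈ inject₁) a)

spoke : ∀ {n} → Fin n → Edge (suc n)
spoke {n} v = fromℕ n , inject₁ v

leaf-conn : ∀ {n} {es : List (Edge n)} → Conn es → ∀ v → Conn (spoke v ∷ liftE es)
leaf-conn conn v = hub⇒conn (λ u w → kleisliStar inject₁ (adj-path ∘ there ∘ adj-liftE) (conn u w)) (adj-path (here (inj₁ refl)))

subdivide-conn : ∀ {n e v₁ v₂} {es : List (Edge n)} → e ≈ (v₁ , v₂) → Conn (e ∷ es) → Conn (spoke v₁ ∷ spoke v₂ ∷ liftE es)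
subdivide-conn {n} {e} {v₁} {v₂} {es} e≈ conn =
  hub⇒conn (λ u w → kleisliStar inject₁ detour (conn u w)) (adj-path (here (inj₁ refl)))
  where
  via : Path (spoke v₁ ∷ spoke v₂ ∷ liftE es) (inject₁ v₁) (inject₁ v₂)
  via = here (inj₂ refl) ◅ there (here (inj₁ refl)) ◅ ε
  detour : ∀ {u w} → Adj (e ∷ es) u w → Path (spoke v₁ ∷ spoke v₂ ∷ liftE es) (inject₁ u) (inject₁ w)
  detour (there a) = adj-path (there (there (adj-liftE a)))
  detour (here e≈uw) with ≈-trans (≈-sym e≈uw) e≈
  ... | inj₁ refl = via
  ... | inj₂ refl = path-sym via

liftE-split : ∀ {n} {es : List (Edge n)} (a b : List (Edge n)) → es ↭ a ++ b → liftE es ↭ liftE a ++ liftE b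
liftE-split a b p = ↭-trans (map-↭ inject₁ p) (↭-reflexive (map-++ (mapE inject₁) a b))

move1-split : ∀ {n} {es : List (Edge n)} v₁ v₂ → TreeMapSplit n es →
              TreeMapSplit (suc n) (liftE es ++ spoke v₁ ∷ spoke v₂ ∷ [])
move1-split {es = es} v₁ v₂ (split a b es↭ conn-a conn-b len-a len-b) =
  split (spoke v₁ ∷ liftE a) (spoke v₂ ∷ liftE b)
    (↭-trans (++-comm (liftE es) _) (↭-prep _ (↭-trans (↭-prep _ (liftE-split a b es↭)) (↭-sym (↭-shift (liftE a) _)))))
    (leaf-conn conn-a v₁) (leaf-conn conn-b v₂)
    (cong suc (trans (cong suc (length-map _ a)) len-a)) (cong suc (trans (length-map _ b) len-b))

module _ {G : Graph} (e : EdgeIx G) {v₁ v₂ : Fin (V G)} (e≈ : Joins G e v₁ v₂) (v₃ : Fin (V G)) where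

  private
    rest = removeAt (E G) e
    sel = select (ends G)
    moved = liftE rest ++ spoke v₁ ∷ spoke v₂ ∷ spoke v₃ ∷ []

    rest-↭ : ∀ {a} → E G ↭ ends G e ∷ a → rest ↭ a
    rest-↭ p = drop-∷ (↭-trans (↭-sym (removeAt-↭ (E G) e)) p)

    moved-↭ : ∀ a b → rest ↭ a ++ b → moved ↭ (spoke v₁ ∷ spoke v₂ ∷ liftE a) ++ spoke v₃ ∷ liftE b
    moved-↭ a b p = ↭-trans (++-comm (liftE rest) _)
      (↭-prep _ (↭-prep _ (↭-trans (↭-prep _ (liftE-split a b p)) (↭-sym (↭-shift (liftE a) _)))))

  -- The part that contains `e` is subdivided by the new vertex, and the other part receives the
  -- spoke to `v₃` as a leaf edge. For `v₃` equal to `v₂` this is a 2b move.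
  move2-split : TreeMapCount G → TreeMapSplit (suc (V G)) moved
  move2-split (T , (connT , lenT) , connM , lenM) with e ∈? T
  ... | yes e∈T =
    split (spoke v₁ ∷ spoke v₂ ∷ liftE (sel T-e)) (spoke v₃ ∷ liftE (sel (∁ T)))
      (moved-↭ (sel T-e) (sel (∁ T)) (rest-↭ (↭-trans (select-split G T) (++⁺ʳ (sel (∁ T)) T↭))))
      (subdivide-conn e≈ (conn-↭ T↭ connT)) (leaf-conn connM v₃)
      (cong suc (trans (cong (2 +_) (length-map _ (sel T-e))) (trans (sym (cong suc (xs↭ys⇒|xs|≡|ys| T↭))) lenT)))
      (cong suc (trans (length-map _ (sel (∁ T))) lenM))
    where
    T-e = T [ e ]≔ outside
    T↭ = select-delete-↭ (ends G) e∈T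
  ... | no e∉T =
    split (spoke v₃ ∷ liftE (sel T)) (spoke v₁ ∷ spoke v₂ ∷ liftE (sel M-e))
      (↭-trans (moved-↭ (sel M-e) (sel T) (rest-↭ (↭-trans (select-split G T) (↭-trans (++-comm (sel T) _) (++⁺ʳ (sel T) M↭)))))
               (++-comm (spoke v₁ ∷ spoke v₂ ∷ liftE (sel M-e)) _))
      (leaf-conn connT v₃) (subdivide-conn e≈ (conn-↭ M↭ connM))
      (cong suc (trans (cong suc (length-map _ (sel T))) lenT))
      (cong suc (trans (cong suc (length-map _ (sel M-e))) (trans (sym (xs↭ys⇒|xs|≡|ys| M↭)) lenM)))
    where
    M-e = ∁ T [ e ]≔ outside
    M↭ = select-delete-↭ (ends G) (x∉p⇒x∈∁p e∉T)

relabel-conn : ∀ {m n} (π : Permutation m n) {es} → Conn es → Conn (map (mapE (π ⟨$⟩ʳ_)) es)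
relabel-conn π conn u v =
  subst₂ (Path _) (inverseʳ π) (inverseʳ π)
    (kleisliStar (π ⟨$⟩ʳ_) (adj-path ∘ Any.map⁺ ∘ Any.map (mapE-≈ (π ⟨$⟩ʳ_))) (conn (π ⟨$⟩ˡ u) (π ⟨$⟩ˡ v)))

iso-split : ∀ {G H} → G ≅ H → TreeMapSplit (V G) (E G) → TreeMapSplit (V H) (E H)
iso-split {G} {H} G≅H@(σ , _) (split a b es↭ conn-a conn-b len-a len-b) =
  split (map (mapE (σ ⟨$⟩ʳ_)) a) (map (mapE (σ ⟨$⟩ʳ_)) b)
    (↭-trans (↭-sym (≅⇒↭ {G} {H} G≅H)) (↭-trans (map-↭ (σ ⟨$⟩ʳ_) es↭) (↭-reflexive (map-++ _ a b))))
    (relabel-conn σ conn-a) (relabel-conn σ conn-b)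
    (trans (cong suc (length-map _ a)) (trans len-a (Permutation.↔⇒≡ σ)))
    (trans (length-map _ b) (trans len-b (Permutation.↔⇒≡ σ)))

constructible⇒treeMapCount : ∀ {G} → Constructible G → TreeMapCount G
constructible⇒treeMapCount baseK11 =
  outside ∷ [] , ((λ where zero zero → ε) , refl) , (λ where zero zero → ε) , refl
constructible⇒treeMapCount baseK23 =
  inside ∷ outside ∷ outside ∷ [] , (conn , refl) , conn , refl
  where
  conn : ∀ {es} → Conn ((zero , suc zero) ∷ es)
  conn zero       zero       = ε
  conn zero       (suc zero) = adj-path (here (inj₁ refl))
  conn (suc zero) zero       = adj-path (here (inj₂ refl))
  conn (suc zero) (suc zero) = ε
constructible⇒treeMapCount (iso {G} {H} G≅H c) =
  split⇒treeMapCount (iso-split {G} {H} G≅H (treeMapCount⇒split {G} (constructible⇒treeMapCount c)))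
constructible⇒treeMapCount (step1a {G} v₁ v₂ _ c) =
  split⇒treeMapCount {move1a G v₁ v₂} (move1-split v₁ v₂ (treeMapCount⇒split {G} (constructible⇒treeMapCount c)))
constructible⇒treeMapCount (step1b {G} v₁ c) =
  split⇒treeMapCount {move1b G v₁} (move1-split v₁ v₁ (treeMapCount⇒split {G} (constructible⇒treeMapCount c)))
constructible⇒treeMapCount (step2a {G} e v₁ v₂ v₃ e≈ _ _ _ c) =
  split⇒treeMapCount {move2a G e v₁ v₂ v₃} (move2-split {G} e e≈ v₃ (constructible⇒treeMapCount c))
constructible⇒treeMapCount (step2b {G} e v₁ v₂ e≈ _ c) =
  split⇒treeMapCount {move2b G e v₁ v₂} (move2-split {G} e e≈ v₂ (constructible⇒treeMapCount c))

-- Vertices of small degree in (2,2)-tight graphs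

handshake : ∀ {n} (es : List (Edge n)) → ∑ (λ x → deg x es) ≡ 2 * length es
handshake {n} []             = sum-replicate-zero n
handshake {n} ((u , v) ∷ es) = begin
  ∑ (λ x → incidence x (u , v) + deg x es)               ≡⟨ ∑-distrib-+ (λ x → incidence x (u , v)) (λ x → deg x es) ⟩
  ∑ (λ x → incidence x (u , v)) + ∑ (λ x → deg x es)     ≡⟨ cong₂ _+_ (∑-distrib-+ (𝟙 ∘ δ u) (𝟙 ∘ δ v)) (handshake es) ⟩
  ∑ (𝟙 ∘ δ u) + ∑ (𝟙 ∘ δ v) + 2 * length es              ≡⟨ cong₂ (λ a b → a + b + 2 * length es) (∑-δ u) (∑-δ v) ⟩
  2 + 2 * length es                                      ≡⟨ *-suc 2 (length es) ⟨
  2 * suc (length es)                                    ∎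
  where open ≡-Reasoning

∑-lower : ∀ {n} (g : Fin n → ℕ) c → (∀ v → c ≤ g v) → n * c ≤ ∑ g
∑-lower {zero}  g c c≤ = z≤n
∑-lower {suc n} g c c≤ = +-mono-≤ (c≤ zero) (∑-lower (g ∘ suc) c (c≤ ∘ suc))

∑-minimal : ∀ {n} (g : Fin n → ℕ) c → (∀ v → c ≤ g v) → ∑ g ≡ n * c → ∀ v → g v ≡ c
∑-minimal {suc n} g c c≤ eq = by-cases
  where
  g₀≡c : g zero ≡ c
  g₀≡c = ≤-antisym
    (+-cancelʳ-≤ (n * c) _ _ (≤-trans (+-monoʳ-≤ (g zero) (∑-lower (g ∘ suc) c (c≤ ∘ suc))) (≤-reflexive eq)))
    (c≤ zero)
  by-cases : ∀ v → g v ≡ c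
  by-cases zero    = g₀≡c
  by-cases (suc v) = ∑-minimal (g ∘ suc) c (c≤ ∘ suc) (+-cancelˡ-≡ c _ _ (trans (cong (_+ ∑ (g ∘ suc)) (sym g₀≡c)) eq)) v

incidence-pos : ∀ {n} (v : Fin n) {u w} → u ≡ v ⊎ w ≡ v → 1 ≤ incidence v (u , w)
incidence-pos v         (inj₁ refl) rewrite δ-refl v = s≤s z≤n
incidence-pos v {u = u} (inj₂ refl) rewrite δ-refl v = m≤n+m 1 (𝟙 (δ u v))

-- Sparsity on the complement of `v` allows at most 2(n - 1) - 2 edges that avoid `v`, so at least
-- two of the 2n - 2 edges meet it. The complement is nonempty because there are at least two
-- vertices.
min-degree : ∀ {k} {es : List (Edge (suc (suc k)))} → Tight22 (suc (suc k)) es → ∀ v → 2 ≤ deg v es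
min-degree {k} {es} t v = arith (length es) (count X es) (deg v es) (size X) (suc (suc k)) (length-eq t)
  (trans (sym (size-⊤ (suc (suc k)))) (size-minus (λ _ → true) v refl))
  (sparse t X (punchIn v zero) (cong (λ b → not b ∧ true) (δ-≢ (punchInᵢ≢i v zero ∘ sym))))
  (begin
    length es                                              ≡⟨ total-1 es ⟨
    total (λ _ → 1) es                                     ≤⟨ total-≤ cover es ⟩
    total (λ e → 𝟙 (inX X e) + incidence v e) es           ≡⟨ total-+ _ (incidence v) es ⟩
    count X es + deg v es                                  ∎)
  where
  open ≤-Reasoning
  X : Fin (suc (suc k)) → Bool
  X y = not (δ v y) ∧ true

  cover : ∀ e → 1 ≤ 𝟙 (inX X e) + incidence v e
  cover (a , b) with v ≟ a
  ... | yes v≡a = incidence-pos v {a} {b} (inj₁ (sym v≡a))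
  ... | no  v≢a with v ≟ b
  ...   | yes v≡b = incidence-pos v {a} {b} (inj₂ (sym v≡b))
  ...   | no  v≢b = s≤s z≤n

  arith : ∀ l c d s n → l + 2 ≡ 2 * n → n ≡ suc s → c + 2 ≤ 2 * s → l ≤ c + d → 2 ≤ d
  arith l c d s _ eq refl c≤ l≤ = linear 2 d (+-mono-≤ (+-mono-≤ (≤-reflexive (sym eq)) c≤) l≤)
    (solve 4 (λ l c d s → con 2 :+ (l :+ con 2 :+ con 2 :* s :+ (c :+ d)) := d :+ (con 2 :* (con 1 :+ s) :+ (c :+ con 2) :+ l)) refl l c d s)
    where open +-*-Solver

-- The edges at the last vertex

spokes : ∀ {m} → List (Edge m) → List (Fin m) → List (Edge (suc m))
spokes r ns = liftE r ++ map spoke ns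

-- The hypothesis counts the loops at the last vertex. Without them each edge is an old edge or,
-- possibly after reversal, a spoke.
neighbourhood : ∀ {m} (es : List (Edge (suc m))) → count (δ (fromℕ m)) es ≡ 0 → ∃[ r ] ∃[ ns ] es ↭ spokes r ns
neighbourhood []             loopless = [] , [] , ↭-refl
neighbourhood {m} ((a , b) ∷ es) loopless
  with r , ns , p ← neighbourhood es (m+n≡0⇒n≡0 (𝟙 (δ (fromℕ m) a ∧ δ (fromℕ m) b)) loopless) with view a | view b
... | ‵fromℕ     | ‵fromℕ     rewrite δ-refl (fromℕ m) = contradiction loopless λ()
... | ‵fromℕ     | ‵inject₁ v = r , v ∷ ns , ↭-trans (↭-prep _ p) (↭-sym (↭-shift (liftE r) _))
... | ‵inject₁ u | ‵fromℕ     = r , u ∷ ns , ↭-trans (Homogeneous.prep (inj₂ refl) p) (↭-sym (↭-shift (liftE r) _))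
... | ‵inject₁ u | ‵inject₁ v = (u , v) ∷ r , ns , ↭-prep _ p

δ-inject₁ : ∀ {m} (u v : Fin m) → δ (inject₁ u) (inject₁ v) ≡ δ u v
δ-inject₁ u v with u ≟ v
... | yes refl = δ-refl (inject₁ u)
... | no u≢v   = δ-≢ (u≢v ∘ inject₁-injective)

deg-inject₁ : ∀ {m} (v : Fin m) r → deg (inject₁ v) (liftE r) ≡ deg v r
deg-inject₁ v r = trans (total-map (incidence (inject₁ v)) (mapE inject₁) r)
  (total-cong (λ (a , b) → cong₂ (λ x y → 𝟙 x + 𝟙 y) (δ-inject₁ a v) (δ-inject₁ b v)) r)

deg-last : ∀ {m} (r : List (Edge m)) ns → deg (fromℕ m) (spokes r ns) ≡ length ns
deg-last {m} r ns = trans (total-++ (incidence (fromℕ m)) (liftE r) (map spoke ns)) (cong₂ _+_ (old r) (new ns))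
  where
  δ-inject₁-last : ∀ u → δ (inject₁ u) (fromℕ m) ≡ false
  δ-inject₁-last u = δ-≢ {x = inject₁ u} (fromℕ≢inject₁ ∘ sym)
  old : ∀ r → deg (fromℕ m) (liftE r) ≡ 0
  old []            = refl
  old ((a , b) ∷ r) rewrite δ-inject₁-last a | δ-inject₁-last b = old r
  new : ∀ ns → deg (fromℕ m) (map spoke ns) ≡ length ns
  new []       = refl
  new (a ∷ ns) rewrite δ-refl (fromℕ m) | δ-inject₁-last a = cong suc (new ns)

extend : ∀ {m} → (Fin m → Bool) → Bool → Fin (suc m) → Bool
extend X b x with view x
... | ‵fromℕ     = b
... | ‵inject₁ u = X u

extend-last : ∀ {m} (X : Fin m → Bool) b → extend X b (fromℕ m) ≡ b
extend-last {m} X b rewrite view-fromℕ m = refl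

extend-inject₁ : ∀ {m} (X : Fin m → Bool) b u → extend X b (inject₁ u) ≡ X u
extend-inject₁ X b u rewrite view-inject₁ u = refl

size-extend : ∀ {m} (X : Fin m → Bool) b → size (extend X b) ≡ size X + 𝟙 b
size-extend X b = trans (sum-init-last (𝟙 ∘ extend X b))
  (cong₂ _+_ (sum-cong-≗ (cong 𝟙 ∘ extend-inject₁ X b)) (cong 𝟙 (extend-last X b)))

count-extend : ∀ {m} (X : Fin m → Bool) b r ns →
               count (extend X b) (spokes r ns) ≡ count X r + total (λ a → 𝟙 (b ∧ X a)) ns
count-extend X b r ns = trans (total-++ (𝟙 ∘ inX (extend X b)) (liftE r) (map spoke ns)) (cong₂ _+_
  (trans (total-map (𝟙 ∘ inX (extend X b)) (mapE inject₁) r)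
         (total-cong (λ (u , v) → cong₂ (λ x y → 𝟙 (x ∧ y)) (extend-inject₁ X b u) (extend-inject₁ X b v)) r))
  (trans (total-map (𝟙 ∘ inX (extend X b)) spoke ns)
         (total-cong (λ a → cong₂ (λ x y → 𝟙 (x ∧ y)) (extend-last X b) (extend-inject₁ X b a)) ns)))

count-cong : ∀ {n} {X Y : Fin n → Bool} → (∀ x → X x ≡ Y x) → ∀ es → count X es ≡ count Y es
count-cong X≗Y = total-cong λ (u , v) → cong₂ (λ a b → 𝟙 (a ∧ b)) (X≗Y u) (X≗Y v)

-- A single vertex has room for 2 · 1 - 2 = 0 edges.
tight22-loopless : ∀ {n es} → Tight22 n es → ∀ x → count (δ x) es ≡ 0
tight22-loopless {es = es} t x = n≤0⇒n≡0 (+-cancelʳ-≤ 2 (count (δ x) es) 0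
  (≤-trans (sparse t (δ x) x (δ-refl x)) (≤-reflexive (cong (2 *_) (∑-δ x)))))

modular : ∀ a b → 𝟙 (a ∨ b) + 𝟙 (a ∧ b) ≡ 𝟙 a + 𝟙 b
modular true  b     = refl
modular false true  = refl
modular false false = refl

-- The inequality is strict only for an edge between a vertex of X outside Y and a vertex of Y
-- outside X, which the union alone counts.
supermodular : ∀ a b c d → 𝟙 (a ∧ b) + 𝟙 (c ∧ d) ≤ 𝟙 ((a ∨ c) ∧ (b ∨ d)) + 𝟙 ((a ∧ c) ∧ (b ∧ d))
supermodular true  true  true  true  = ≤-refl
supermodular true  true  true  false = ≤-refl
supermodular true  true  false true  = ≤-refl
supermodular true  true  false false = ≤-refl
supermodular true  false true  true  = ≤-refl
supermodular true  false true  false = z≤n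
supermodular true  false false d     = z≤n
supermodular false true  true  true  = ≤-refl
supermodular false true  true  false = z≤n
supermodular false true  false d     = z≤n
supermodular false false true  true  = ≤-refl
supermodular false false true  false = z≤n
supermodular false false false d     = z≤n

module _ {m : ℕ} {es : List (Edge (suc m))} (t : Tight22 (suc m) es) where

  sparse-old : ∀ r ns → es ↭ spokes r ns → ∀ X x → X x ≡ true → count X r + 2 ≤ 2 * size X
  sparse-old r ns p X x x∈X = begin
    count X r + 2                                           ≤⟨ +-monoˡ-≤ 2 (m≤m+n (count X r) _) ⟩
    count X r + total (λ a → 𝟙 (false ∧ X a)) ns + 2        ≡⟨ cong (_+ 2) (count-extend X false r ns) ⟨
    count X⁺ (spokes r ns) + 2                              ≡⟨ cong (_+ 2) (count-↭ X⁺ p) ⟨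
    count X⁺ es + 2                                         ≤⟨ sparse t X⁺ (inject₁ x) (trans (extend-inject₁ X false x) x∈X) ⟩
    2 * size X⁺                                             ≡⟨ cong (2 *_) (trans (size-extend X false) (+-identityʳ (size X))) ⟩
    2 * size X                                              ∎
    where
    open ≤-Reasoning
    X⁺ = extend X false

  -- Sparsity for `X` with the last vertex added: the larger size raises the right side by 2, which
  -- cancels the constant 2.
  sparse-new : ∀ r ns → es ↭ spokes r ns → ∀ X → count X r + total (𝟙 ∘ X) ns ≤ 2 * size X
  sparse-new r ns p X = +-cancelʳ-≤ 2 _ _ (begin
    count X r + total (𝟙 ∘ X) ns + 2                        ≡⟨ cong (_+ 2) (count-extend X true r ns) ⟨
    count X⁺ (spokes r ns) + 2                              ≡⟨ cong (_+ 2) (count-↭ X⁺ p) ⟨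
    count X⁺ es + 2                                         ≤⟨ sparse t X⁺ (fromℕ m) (extend-last X true) ⟩
    2 * size X⁺                                             ≡⟨ cong (2 *_) (size-extend X true) ⟩
    2 * (size X + 1)                                        ≡⟨ *-distribˡ-+ 2 (size X) 1 ⟩
    2 * size X + 2                                          ∎)
    where
    open ≤-Reasoning
    X⁺ = extend X true

  length-spokes : ∀ r ns → es ↭ spokes r ns → length r + length ns ≡ 2 * m
  length-spokes r ns p = +-cancelʳ-≡ 2 _ _ (begin
    length r + length ns + 2                   ≡⟨ cong₂ (λ a b → a + b + 2) (length-map (mapE inject₁) r) (length-map spoke ns) ⟨
    length (liftE r) + length (map spoke ns) + 2 ≡⟨ cong (_+ 2) (length-++ (liftE r)) ⟨
    length (spokes r ns) + 2                   ≡⟨ cong (_+ 2) (xs↭ys⇒|xs|≡|ys| p) ⟨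
    length es + 2                              ≡⟨ length-eq t ⟩
    2 * suc m                                  ≡⟨ *-suc 2 m ⟩
    2 + 2 * m                                  ≡⟨ +-comm 2 (2 * m) ⟩
    2 * m + 2                                  ∎)
    where open ≡-Reasoning

  tight22-delete2 : ∀ r p q → es ↭ spokes r (p ∷ q ∷ []) → Tight22 m r
  tight22-delete2 r p q es↭ = tight22 (length-spokes r _ es↭) (sparse-old r _ es↭)

  -- Replacing a vertex of degree 3 by an edge ab fails only if some tight set contains a and b.
  module _ (r : List (Edge m)) {ns : List (Fin m)} (len : length ns ≡ 3) (es↭ : es ↭ spokes r ns) where

    -- By `sparse-old` the inequality is an equality: `X` has no room for a further edge.
    Blocks : Fin m → Fin m → (Fin m → Bool) → Set
    Blocks a b X = (X a ≡ true × X b ≡ true) × 2 * size X ≤ count X r + 2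

    -- The choice of the replacement edge has to be decided constructively, which a search through
    -- the finitely many vertex sets does.
    blocked? : ∀ a b → (∃[ X ] Blocks a b X) ⊎ (∀ X → ¬ Blocks a b X)
    blocked? a b with anySubset? (λ p → ((Vec.lookup p a Bool.≟ true) ×-dec (Vec.lookup p b Bool.≟ true))
                                          ×-dec (2 * size (Vec.lookup p) ≤? count (Vec.lookup p) r + 2))
    ... | yes (p , blocks) = inj₁ (Vec.lookup p , blocks)
    ... | no none = inj₂ λ X ((a∈ , b∈) , le) → none (Vec.tabulate X ,
            (trans (lookup∘tabulate X a) a∈ , trans (lookup∘tabulate X b) b∈) ,
            subst₂ (λ s c → 2 * s ≤ c + 2) (sym (sum-cong-≗ (cong 𝟙 ∘ lookup∘tabulate X)))
              (sym (count-cong (lookup∘tabulate X) r)) le)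

    replace : ∀ {a b} → (∀ X → ¬ Blocks a b X) → Tight22 m ((a , b) ∷ r)
    replace {a} {b} unblocked = tight22
      (trans (sym (+-suc (length r) 2)) (trans (cong (length r +_) (sym len)) (length-spokes r _ es↭)))
      bound
      where
      bound : ∀ X x → X x ≡ true → count X ((a , b) ∷ r) + 2 ≤ 2 * size X
      bound X x x∈X with X a in a∈ | X b in b∈
      -- For a set that does not block, the strict inequality leaves room for the new edge.
      ... | true  | true  = ≰⇒> λ le → unblocked X ((a∈ , b∈) , le)
      ... | true  | false = sparse-old r _ es↭ X x x∈X
      ... | false | _     = sparse-old r _ es↭ X x x∈X

    -- With the deleted vertex added, such a set would gain 3 edges where a tight set has room for
    -- only 2.
    not-all : ∀ X → total (𝟙 ∘ X) ns ≡ 3 → ¬ 2 * size X ≤ count X r + 2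
    not-all X all le = m+1+n≰m (count X r + 2) {0} (≤-trans
      (≤-reflexive (trans (+-assoc (count X r) 2 1) (cong (count X r +_) (sym all))))
      (≤-trans (sparse-new r _ es↭ X) le))

  -- For distinct neighbours the pairs pq and ps suffice: sets blocking both share `p`, so sparsity
  -- applies to their intersection. If exactly two neighbours coincide, a set containing two
  -- distinct ones contains all three. The third end `c` may equal `a` or `b`.
  tight22-delete3 : ∀ r p q s → es ↭ spokes r (p ∷ q ∷ s ∷ []) →
    ∃[ a ] ∃[ b ] ∃[ c ] a ≢ b × map spoke (p ∷ q ∷ s ∷ []) ↭ map spoke (a ∷ b ∷ c ∷ []) × Tight22 m ((a , b) ∷ r)
  tight22-delete3 r p q s es↭ = go (p ≟ q) (p ≟ s) (q ≟ s)
    where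
    all-in : ∀ {X : Fin m → Bool} → X p ≡ true → X q ≡ true → X s ≡ true → total (𝟙 ∘ X) (p ∷ q ∷ s ∷ []) ≡ 3
    all-in p∈ q∈ s∈ rewrite p∈ | q∈ | s∈ = refl

    free : ∀ {a b} → (∀ X → X a ≡ true → X b ≡ true → X p ≡ true × X q ≡ true × X s ≡ true) → Tight22 m ((a , b) ∷ r)
    free contains = replace r refl es↭ λ X ((a∈ , b∈) , le) →
      let p∈ , q∈ , s∈ = contains X a∈ b∈ in not-all r refl es↭ X (all-in p∈ q∈ s∈) le

    -- Uncrossing: the union of tight sets meeting in p is tight.
    uncross : ∀ X Y → Blocks r {p ∷ q ∷ s ∷ []} refl es↭ p q X → ¬ Blocks r {p ∷ q ∷ s ∷ []} refl es↭ p s Y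
    uncross X Y ((p∈X , q∈X) , X-tight) ((p∈Y , s∈Y) , Y-tight) =
      not-all r refl es↭ X∪Y (all-in (cong (_∨ Y p) p∈X) (cong (_∨ Y q) q∈X) (trans (cong (X s ∨_) s∈Y) (∨-zeroʳ (X s))))
        (arith (size X) (size Y) (size X∪Y) (size X∩Y) (count X r) (count Y r) (count X∪Y r) (count X∩Y r)
          sizes counts X-tight Y-tight (sparse-old r _ es↭ X∩Y p (cong₂ _∧_ p∈X p∈Y)))
      where
      X∪Y X∩Y : Fin m → Bool
      X∪Y x = X x ∨ Y x
      X∩Y x = X x ∧ Y x

      sizes : size X∪Y + size X∩Y ≡ size X + size Y
      sizes = trans (sym (∑-distrib-+ (𝟙 ∘ X∪Y) (𝟙 ∘ X∩Y)))
        (trans (sum-cong-≗ (λ x → modular (X x) (Y x))) (∑-distrib-+ (𝟙 ∘ X) (𝟙 ∘ Y)))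

      counts : count X r + count Y r ≤ count X∪Y r + count X∩Y r
      counts = ≤-trans (≤-reflexive (sym (total-+ (𝟙 ∘ inX X) (𝟙 ∘ inX Y) r)))
        (≤-trans (total-≤ (λ (u , v) → supermodular (X u) (X v) (Y u) (Y v)) r)
                 (≤-reflexive (total-+ (𝟙 ∘ inX X∪Y) (𝟙 ∘ inX X∩Y) r)))

      arith : ∀ x y u i cx cy cu ci → u + i ≡ x + y → cx + cy ≤ cu + ci → 2 * x ≤ cx + 2 → 2 * y ≤ cy + 2 →
              ci + 2 ≤ 2 * i → 2 * u ≤ cu + 2
      arith x y u i cx cy cu ci sz cnt hx hy hi =
        linear (2 * u) (cu + 2) (+-mono-≤ (+-mono-≤ (+-mono-≤ (+-mono-≤ cnt hx) hy) hi) (*-monoʳ-≤ 2 (≤-reflexive sz)))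
          (solve 8 (λ x y u i cx cy cu ci →
             con 2 :* u :+ (cu :+ ci :+ (cx :+ con 2) :+ (cy :+ con 2) :+ con 2 :* i :+ con 2 :* (x :+ y)) :=
             cu :+ con 2 :+ (cx :+ cy :+ con 2 :* x :+ con 2 :* y :+ (ci :+ con 2) :+ con 2 :* (u :+ i)))
             refl x y u i cx cy cu ci)
        where open +-*-Solver

    psq↭ : map spoke (p ∷ q ∷ s ∷ []) ↭ map spoke (p ∷ s ∷ q ∷ [])
    psq↭ = ↭-prep _ (↭-swap _ _ ↭-refl)

    go : Dec (p ≡ q) → Dec (p ≡ s) → Dec (q ≡ s) → _
    go (yes refl) (no p≢s)   _          = p , s , q , p≢s , psq↭ , free (λ X p∈ s∈ → p∈ , p∈ , s∈)
    go (no p≢q)   (yes refl) _          = p , q , s , p≢q , ↭-refl , free (λ X p∈ q∈ → p∈ , q∈ , p∈)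
    go (no p≢q)   (no _)     (yes refl) = p , q , s , p≢q , ↭-refl , free (λ X p∈ q∈ → p∈ , q∈ , q∈)
    go (no p≢q)   (no p≢s)   (no _) with blocked? r refl es↭ p q | blocked? r refl es↭ p s
    ... | inj₂ unblocked | _              = p , q , s , p≢q , ↭-refl , replace r refl es↭ unblocked
    ... | inj₁ _         | inj₂ unblocked = p , s , q , p≢s , psq↭ , replace r refl es↭ unblocked
    ... | inj₁ (X , X-blocks) | inj₁ (Y , Y-blocks) = contradiction Y-blocks (uncross X Y X-blocks)
    -- Three parallel edges do not fit on two vertices, which carry at most 2 · 2 - 2.
    go (yes refl) (yes refl) _ = contradiction
      (≤-trans (m≤n+m 3 (count (δ p) r)) (≤-trans triple (≤-reflexive (cong (2 *_) (∑-δ p))))) λ where (s≤s (s≤s ()))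
      where
      triple : count (δ p) r + 3 ≤ 2 * size (δ p)
      triple = subst (λ n → count (δ p) r + n ≤ 2 * size (δ p)) (all-in {δ p} (δ-refl p) (δ-refl p) (δ-refl p)) (sparse-new r _ es↭ (δ p))

-- Building a (2,2)-tight graph plus one edge

constructible-move1 : ∀ {m} {es : List (Edge m)} → Constructible (graph m es) → ∀ p q →
                      Constructible (graph (suc m) (spokes es (p ∷ q ∷ [])))
constructible-move1 c p q with p ≟ q
... | yes refl = step1b p c
... | no p≢q   = step1a p q p≢q c

-- The position of `c` decides the move: a third vertex gives 2a, an end of the removed edge gives
-- 2b with that end joined twice.
constructible-move2 : ∀ {m a b} {es : List (Edge m)} → a ≢ b → Constructible (graph m ((a , b) ∷ es)) → ∀ c →
                      Constructible (graph (suc m) (spokes es (a ∷ b ∷ c ∷ [])))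
constructible-move2 {a = a} {b} {es} a≢b con c with c ≟ a | c ≟ b
... | no c≢a   | no c≢b   = step2a zero a b c (inj₁ refl) a≢b c≢a c≢b con
... | no _     | yes refl = step2b zero a b (inj₁ refl) a≢b con
... | yes refl | _        = constructible-↭ (++⁺ˡ (liftE es) (↭-swap _ _ ↭-refl)) (step2b zero b a (inj₂ refl) (a≢b ∘ sym) con)

tight22-relabel : ∀ {n es} (π : Permutation n n) → Tight22 n es → Tight22 n (map (mapE (π ⟨$⟩ʳ_)) es)
tight22-relabel {es = es} π t = tight22 (trans (cong (_+ 2) (length-map _ es)) (length-eq t)) λ X x x∈X →
  subst₂ (λ c s → c + 2 ≤ 2 * s)
    (sym (total-map (𝟙 ∘ inX X) (mapE (π ⟨$⟩ʳ_)) es))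
    (sym (sum-permute (𝟙 ∘ X) π))
    (sparse t (X ∘ (π ⟨$⟩ʳ_)) (π ⟨$⟩ˡ x) (trans (cong X (inverseʳ π)) x∈X))

deg-relabel : ∀ {n} (π : Permutation n n) v es → deg (π ⟨$⟩ʳ v) (map (mapE (π ⟨$⟩ʳ_)) es) ≡ deg v es
deg-relabel π v es = trans (total-map (incidence (π ⟨$⟩ʳ v)) (mapE (π ⟨$⟩ʳ_)) es)
  (total-cong (λ (a , b) → cong₂ (λ x y → 𝟙 x + 𝟙 y) (δ-π a) (δ-π b)) es)
  where
  δ-π : ∀ a → δ (π ⟨$⟩ʳ a) (π ⟨$⟩ʳ v) ≡ δ a v
  δ-π a with a ≟ v
  ... | yes refl = δ-refl (π ⟨$⟩ʳ a)
  ... | no a≢v   = δ-≢ λ eq → a≢v (trans (sym (inverseˡ π)) (trans (cong (π ⟨$⟩ˡ_) eq) (inverseˡ π)))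

constructible-relabel⁻ : ∀ {n} (π : Permutation n n) {es : List (Edge n)} →
                         Constructible (graph n (map (mapE (π ⟨$⟩ʳ_)) es)) → Constructible (graph n es)
constructible-relabel⁻ {n} π {es} c =
  subst (Constructible ∘ graph n)
    (trans (sym (map-∘ es)) (trans (map-cong (λ _ → cong₂ _,_ (inverseˡ π) (inverseˡ π)) es) (map-id es)))
    (iso (relabel-≅ (Permutation.flip π) (map (mapE (π ⟨$⟩ʳ_)) es)) c)

transpose-fst : ∀ {n} (i j : Fin n) → Permutation.transpose i j ⟨$⟩ʳ i ≡ j
transpose-fst i j rewrite dec-true (i ≟ i) refl = refl

-- The moves add their new vertex as `fromℕ m`, so a vertex to be removed is carried there by a
-- relabelling; `π-other` keeps the remaining ends in the range of `inject₁`.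
record MovedLast {m : ℕ} (es : List (Edge (suc m))) (v : Fin (suc m)) : Set where
  field
    π         : Permutation (suc m) (suc m)
    r         : List (Edge m)
    ns        : List (Fin m)
    π-v       : π ⟨$⟩ʳ v ≡ fromℕ m
    π-other   : ∀ {x} → x ≢ v → ∃[ y ] π ⟨$⟩ʳ x ≡ inject₁ y
    es↭       : map (mapE (π ⟨$⟩ʳ_)) es ↭ spokes r ns
    length-ns : length ns ≡ deg v es

move-last : ∀ {m es} → Tight22 (suc m) es → ∀ v → MovedLast es v
move-last {m} {es} t v
  with r , ns , es↭ ← neighbourhood (map (mapE (Permutation.transpose v (fromℕ m) ⟨$⟩ʳ_)) es)
                        (tight22-loopless (tight22-relabel (Permutation.transpose v (fromℕ m)) t) (fromℕ m)) = record
  { π         = π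
  ; r         = r
  ; ns        = ns
  ; π-v       = π-v
  ; π-other   = λ x≢v → below-last λ πx≡last →
                  x≢v (trans (sym (inverseˡ π)) (trans (cong (π ⟨$⟩ˡ_) (trans πx≡last (sym π-v))) (inverseˡ π)))
  ; es↭       = es↭
  ; length-ns = trans (sym (deg-last r ns)) (trans (sym (deg-↭ (fromℕ m) es↭))
                  (trans (cong (λ x → deg x (map (mapE (π ⟨$⟩ʳ_)) es)) (sym π-v)) (deg-relabel π v es)))
  }
  where
  π = Permutation.transpose v (fromℕ m)
  π-v = transpose-fst v (fromℕ m)
  below-last : ∀ {x : Fin (suc m)} → x ≢ fromℕ m → ∃[ y ] x ≡ inject₁ y
  below-last {x} x≢ with view x
  ... | ‵fromℕ     = contradiction refl x≢
  ... | ‵inject₁ y = y , refl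

module _ {m : ℕ} (build : ∀ es e → Tight22 m es → Constructible (graph m (e ∷ es))) where

  -- The edge `e` remains the extra edge of the smaller graph. In degree 3 the replacement edge
  -- `(a , b)` belongs to the tight part and comes to the head of the list only to be removed by the
  -- 2-move.
  reduce-away : ∀ {es} r ns → Tight22 (suc m) es → es ↭ spokes r ns → 2 ≤ length ns → length ns ≤ 3 →
                ∀ e → Constructible (graph (suc m) (mapE inject₁ e ∷ es))
  reduce-away r (p ∷ q ∷ []) t es↭ _ _ e =
    constructible-↭ (↭-prep _ (↭-sym es↭)) (constructible-move1 (build r e (tight22-delete2 t r p q es↭)) p q)
  reduce-away r (p ∷ q ∷ s ∷ []) t es↭ _ _ e
    with a , b , c , a≢b , pqs↭abc , t′ ← tight22-delete3 t r p q s es↭ =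
    constructible-↭ (↭-prep _ (↭-trans (++⁺ˡ (liftE r) (↭-sym pqs↭abc)) (↭-sym es↭)))
      (constructible-move2 a≢b (constructible-↭ (↭-swap _ _ ↭-refl) (build ((a , b) ∷ r) e t′)) c)
  reduce-away r (_ ∷ []) t es↭ (s≤s ()) _ e
  reduce-away r (_ ∷ _ ∷ _ ∷ _ ∷ _) t es↭ _ (s≤s (s≤s (s≤s ()))) e

  -- The last vertex is joined to `p`, `q` and, by the extra edge, to `b`. Two distinct ends among
  -- these form the extra edge of the smaller graph, which the 2-move then removes.
  reduce-at : ∀ {es} r ns → Tight22 (suc m) es → es ↭ spokes r ns → length ns ≡ 2 →
              ∀ b → deg (inject₁ b) es ≡ 2 → Constructible (graph (suc m) (spoke b ∷ es))
  reduce-at {es} r (p ∷ q ∷ []) t es↭ _ b deg≡2 = go (p ≟ q) (p ≟ b)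
    where
    t′ : Tight22 m r
    t′ = tight22-delete2 t r p q es↭

    rotate : ∀ ns → map spoke ns ↭ map spoke (b ∷ p ∷ q ∷ []) → spokes r ns ↭ spoke b ∷ es
    rotate ns ns↭ = ↭-trans (++⁺ˡ (liftE r) ns↭) (↭-trans (↭-shift (liftE r) _) (↭-prep _ (↭-sym es↭)))

    -- Both tight edges at `b` lead to the removed vertex, so `b` is isolated in `r`. By the minimum
    -- degree it is then the only vertex left.
    triple : ∀ {m} {r : List (Edge m)} {b es} → Tight22 m r → es ↭ spokes r (b ∷ b ∷ []) → deg (inject₁ b) es ≡ 2 →
             Constructible (graph (suc m) (spoke b ∷ es))
    triple {suc (suc k)} {r} {b} {es} t es↭ deg≡2 = contradiction (min-degree t b) (<⇒≱ (s≤s (≤-trans (≤-reflexive deg≡0) z≤n)))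
      where
      at-b : deg (inject₁ b) (map spoke (b ∷ b ∷ [])) ≡ 2
      at-b rewrite δ-refl (inject₁ b) | δ-≢ (fromℕ≢inject₁ {i = b}) = refl
      deg≡0 : deg b r ≡ 0
      deg≡0 = +-cancelʳ-≡ 2 _ _ (trans (sym (trans (deg-↭ (inject₁ b) es↭)
        (trans (total-++ (incidence (inject₁ b)) (liftE r) _) (cong₂ _+_ (deg-inject₁ b r) at-b)))) deg≡2)
    triple {suc zero} {[]}    {zero} t es↭ _ =
      constructible-↭ (↭-trans (Homogeneous.prep (inj₂ refl) (Homogeneous.prep (inj₂ refl) (Homogeneous.prep (inj₂ refl) ↭-refl)))
                               (↭-prep _ (↭-sym es↭))) baseK23
    triple {suc zero} {_ ∷ r} t _ _ = contradiction (+-cancelʳ-≡ 2 (suc (length r)) 0 (length-eq t)) λ()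

    go : Dec (p ≡ q) → Dec (p ≡ b) → Constructible (graph (suc m) (spoke b ∷ es))
    go (no p≢q)   _          = constructible-↭ (rotate (p ∷ q ∷ b ∷ []) (++-comm (map spoke (p ∷ q ∷ [])) _))
                                 (constructible-move2 p≢q (build r (p , q) t′) b)
    go (yes refl) (no p≢b)   = constructible-↭ (rotate (p ∷ b ∷ p ∷ []) (↭-swap _ _ ↭-refl))
                                 (constructible-move2 p≢b (build r (p , b) t′) p)
    go (yes refl) (yes refl) = triple t′ es↭ deg≡2

build-step : ∀ {k} → (∀ es e → Tight22 (suc k) es → Constructible (graph (suc k) (e ∷ es))) →
             ∀ es e → Tight22 (suc (suc k)) es → Constructible (graph (suc (suc k)) (e ∷ es))
build-step {k} build es (a , b) t with any? (λ v → deg v ((a , b) ∷ (a , b) ∷ es) ≤? 3)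
... | yes (v , deg≤3) =
  constructible-relabel⁻ π (subst₂ (λ x y → Constructible (graph _ ((x , y) ∷ es′))) (sym (proj₂ a′)) (sym (proj₂ b′))
    (reduce-away build r ns (tight22-relabel π t) es↭
      (≤-trans (min-degree t v) (≤-reflexive (sym length-ns)))
      (≤-trans (≤-reflexive length-ns) (≤-trans (≤-trans (m≤n+m _ inc) (m≤n+m _ inc)) deg≤3))
      (proj₁ a′ , proj₁ b′)))
  where
  open MovedLast (move-last t v)
  es′ = map (mapE (π ⟨$⟩ʳ_)) es
  inc = incidence v (a , b)

  inc≯0 : ∀ i d → i + (i + d) ≤ 3 → 2 ≤ d → ¬ 1 ≤ i
  inc≯0 i d le 2≤d 1≤i = contradiction (≤-trans (+-mono-≤ 1≤i (+-mono-≤ 1≤i 2≤d)) le) λ where (s≤s (s≤s (s≤s ())))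

  away : ∀ {x} → a ≡ x ⊎ b ≡ x → x ≢ v
  away x∈e refl = inc≯0 inc (deg v es) deg≤3 (min-degree t v) (incidence-pos v {a} {b} x∈e)

  a′ = π-other (away (inj₁ refl))
  b′ = π-other (away (inj₂ refl))
... | no none =
  constructible-relabel⁻ π (subst₂ (λ x y → Constructible (graph _ ((x , y) ∷ es′))) (sym π-v) (sym (proj₂ b′))
    (reduce-at build r ns (tight22-relabel π t) es↭ (trans length-ns deg-a) (proj₁ b′)
      (trans (cong (λ x → deg x es′) (sym (proj₂ b′))) (trans (deg-relabel π b es) deg-b))))
  where
  open MovedLast (move-last t a)
  es′ = map (mapE (π ⟨$⟩ʳ_)) es

  all-4 : ∀ v → deg v ((a , b) ∷ (a , b) ∷ es) ≡ 4
  all-4 = ∑-minimal _ 4 (λ v → ≰⇒> (λ le → none (v , le)))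
    (trans (handshake ((a , b) ∷ (a , b) ∷ es))
    (trans (cong (2 *_) (trans (+-comm 2 (length es)) (length-eq t))) (regroup (suc (suc k)))))
    where
    regroup : ∀ n → 2 * (2 * n) ≡ n * 4
    regroup = solve 1 (λ n → con 2 :* (con 2 :* n) := n :* con 4) refl
      where open +-*-Solver

  -- A loop listed twice would use up the degree 4 and leave degree 0 in `es`.
  a≢b : a ≢ b
  a≢b refl = contradiction (min-degree t a) (<⇒≱ (≤-trans (≤-reflexive (cong suc deg≡0)) (s≤s z≤n)))
    where
    deg≡0 : deg a es ≡ 0
    deg≡0 = +-cancelˡ-≡ 4 _ _ (subst (λ c → 𝟙 c + 𝟙 c + (𝟙 c + 𝟙 c + deg a es) ≡ 4) (δ-refl a) (all-4 a))

  deg-a : deg a es ≡ 2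
  deg-a = +-cancelˡ-≡ 2 _ _ (subst₂ (λ c d → 𝟙 c + 𝟙 d + (𝟙 c + 𝟙 d + deg a es) ≡ 4) (δ-refl a) (δ-≢ (a≢b ∘ sym)) (all-4 a))

  deg-b : deg b es ≡ 2
  deg-b = +-cancelˡ-≡ 2 _ _ (subst₂ (λ c d → 𝟙 c + 𝟙 d + (𝟙 c + 𝟙 d + deg b es) ≡ 4) (δ-≢ a≢b) (δ-refl b) (all-4 b))

  b′ = π-other (a≢b ∘ sym)

tight22⇒constructible : ∀ n es e → Tight22 n es → Constructible (graph n (e ∷ es))
tight22⇒constructible zero          es       e             t = contradiction (m+n≡0⇒n≡0 (length es) (length-eq t)) λ()
-- On one vertex tightness leaves no edge, so the extra edge is the loop of `K11`.
tight22⇒constructible (suc zero)    []       (zero , zero) t = baseK11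
tight22⇒constructible (suc zero)    (_ ∷ es) e             t = contradiction (+-cancelʳ-≡ 2 (suc (length es)) 0 (length-eq t)) λ()
tight22⇒constructible (suc (suc k)) es       e             t = build-step (tight22⇒constructible (suc k)) es e t

P21⇒constructible : ∀ {G} → P21 G → Constructible G
P21⇒constructible {G} p@(_ , e , _) = constructible-↭ (↭-sym (removeAt-↭ (E G) e))
  (tight22⇒constructible (V G) (removeAt (E G) e) (lookup (E G) e) (P21⇒tight22 G p))

theorem5p11 : (G : Graph) →
    (P21 G ⇔ Constructible G) × (P21 G ⇔ TreeMapDecomposition G)
theorem5p11 G =
  mk⇔ (P21⇒constructible {G}) (treeMapCount⇒P21 {G} ∘ constructible⇒treeMapCount) ,
  mk⇔ (treeMapCount⇒decomposition {G} ∘ constructible⇒treeMapCount ∘ P21⇒constructible {G})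
      (treeMapCount⇒P21 {G} ∘ decomposition⇒treeMapCount {G})
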